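{- The class of $(P_1+2P_2,K_3)$-free graphs has bounded clique-width. That is, there is a constant $k$ such that every graph $G$ containing no induced subgraph isomorphic to $P_1+2P_2$ and no induced subgraph isomorphic to $K_3$ satisfies $cw(G)\le k$.
   Context: All graphs are finite, simple and undirected. For a set $\mathcal{H}$ of graphs, a graph is $\mathcal{H}$-free if it has no induced subgraph isomorphic to a member of $\mathcal{H}$. $K_3$ (the triangle) is the complete graph on three vertices. $P_1+2P_2$ is the disjoint union of one isolated vertex and two single edges (a graph on five vertices with exactly two edges, which are disjoint). The clique-width $cw(G)$ of a graph $G$ is the minimum number of labels needed to construct $G$ using the following four operations on vertex-labeled graphs: (i) creating a new vertex with an (integer) label; (ii) taking the disjoint union of two vertex-labeled, vertex-disjoint graphs; (iii) for two labels $i\ne j$, adding all edges between the set of all vertices with label $i$ and the set of all vertices with label $j$; (iv) renaming label $i$ to label $j$. A class of graphs has bounded clique-width if there is a constant $k$ with $cw(G)\le k$ for all $G$ in the class. -}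

module Defs where

open import Level using (0ℓ; suc)
open import Data.Bool using (if_then_else_)
open import Data.Nat as ℕ using (ℕ; _+_)
import Data.Nat.Properties as ℕ
open import Data.Fin using (Fin; toℕ; splitAt; _≟_)
open import Data.List using (List)
open import Data.List.Relation.Unary.All using (All)
open import Data.Product using (Σ-syntax; ∃-syntax; _×_)
open import Data.Sum using (_⊎_; [_,_])
import Data.Sum as Sum
open import Data.Sum.Relation.Binary.Pointwise using (Pointwise; inj₁; inj₂; ⊎-symmetric; ⊎-decidable)
open import Data.Unit using (⊤)
open import Data.Empty using (⊥)
open import Function using (_↔_; _⇔_; Inverse; Injective)
open import Relation.Binary using (Rel; Decidable; Symmetric; Irreflexive)
open import Relation.Binary.PropositionalEquality using (_≡_; _≢_; refl; sym; ≢-sym)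
open import Relation.Nullary using (¬_; does; ¬?; _⊎-dec_)
open import Relation.Unary using (Pred)

record Graph : Set₁ where
  field
    order  : ℕ
    _~_    : Rel (Fin order) 0ℓ
    ~-irr  : Irreflexive _≡_ _~_
    ~-sym  : Symmetric _~_
    _~?_   : Decidable _~_

  Vertex : Set
  Vertex = Fin order

open Graph using (order; Vertex)

Complete : ℕ → Graph
Complete n = record
  { order = n
  ; _~_   = _≢_
  ; ~-irr = λ i≡j i≢j → i≢j i≡j
  ; ~-sym = ≢-sym
  ; _~?_  = λ i j → ¬? (i ≟ j)
  }

-- n counts vertices, not edges.
Path : ℕ → Graph
Path n = record
  { order = n
  ; _~_   = λ i j → (toℕ j ≡ ℕ.suc (toℕ i)) ⊎ (toℕ i ≡ ℕ.suc (toℕ j))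
  ; ~-irr = λ { refl → [ (λ eq → ℕ.1+n≢n (sym eq)) , (λ eq → ℕ.1+n≢n (sym eq)) ] }
  ; ~-sym = Sum.swap
  ; _~?_  = λ i j → (toℕ j ℕ.≟ ℕ.suc (toℕ i)) ⊎-dec (toℕ i ℕ.≟ ℕ.suc (toℕ j))
  }

infixr 6 _⊍_

-- Disjoint union: the first `order G` vertices form a copy of G, the
-- remaining ones a copy of H; Pointwise allows no edge between the copies.
_⊍_ : Graph → Graph → Graph
G ⊍ H = record
  { order = order G + order H
  ; _~_   = λ u v → Pointwise G._~_ H._~_ (splitAt (order G) u) (splitAt (order G) v)
  ; ~-irr = λ { {u} refl → irr (splitAt (order G) u) }
  ; ~-sym = ⊎-symmetric G.~-sym H.~-sym
  ; _~?_  = λ u v → ⊎-decidable G._~?_ H._~?_ (splitAt (order G) u) (splitAt (order G) v)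
  }
  where
  module G = Graph G
  module H = Graph H
  irr : ∀ x → ¬ Pointwise G._~_ H._~_ x x
  irr _ (inj₁ p) = G.~-irr refl p
  irr _ (inj₂ p) = H.~-irr refl p

P₁+2P₂ : Graph
P₁+2P₂ = Path 1 ⊍ Path 2 ⊍ Path 2

K₃ : Graph
K₃ = Complete 3

-- H is isomorphic to an induced subgraph of G (the one induced by the image
-- of f): adjacency is both preserved and reflected.
_InducedIn_ : Graph → Graph → Set
H InducedIn G =
  Σ[ f ∈ (Vertex H → Vertex G) ]
    Injective _≡_ _≡_ f × (∀ u v → Graph._~_ H u v ⇔ Graph._~_ G (f u) (f v))

Free : List Graph → Pred Graph (suc 0ℓ)
Free Hs G = All (λ H → ¬ (H InducedIn G)) Hs

record LabelledGraph (k : ℕ) : Set₁ where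
  field
    V     : Set
    label : V → Fin k
    _~_   : Rel V 0ℓ

module _ {k : ℕ} where

  singleton : Fin k → LabelledGraph k
  singleton i = record { V = ⊤ ; label = λ _ → i ; _~_ = λ _ _ → ⊥ }

  disjointUnion : LabelledGraph k → LabelledGraph k → LabelledGraph k
  disjointUnion A B = record
    { V     = A.V ⊎ B.V
    ; label = [ A.label , B.label ]
    ; _~_   = Pointwise A._~_ B._~_
    }
    where
    module A = LabelledGraph A
    module B = LabelledGraph B

  addEdges : Fin k → Fin k → LabelledGraph k → LabelledGraph k
  addEdges i j A = record
    { V     = V
    ; label = label
    ; _~_   = λ u v → u ~ v
                    ⊎ (label u ≡ i × label v ≡ j)
                    ⊎ (label u ≡ j × label v ≡ i)
    }
    where open LabelledGraph A

  rename : Fin k → Fin k → LabelledGraph k → LabelledGraph k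
  rename i j A = record
    { V     = V
    ; label = λ v → if does (label v ≟ i) then j else label v
    ; _~_   = _~_
    }
    where open LabelledGraph A

-- Constructions by the four clique-width operations with labels from a
-- fixed set of k labels.
data Expr (k : ℕ) : Set where
  new  : Fin k → Expr k
  _⊕_  : Expr k → Expr k → Expr k
  join : (i j : Fin k) → i ≢ j → Expr k → Expr k
  ren  : (i j : Fin k) → Expr k → Expr k

⟦_⟧ : ∀ {k} → Expr k → LabelledGraph k
⟦ new i ⟧        = singleton i
⟦ e ⊕ f ⟧        = disjointUnion ⟦ e ⟧ ⟦ f ⟧
⟦ join i j _ e ⟧ = addEdges i j ⟦ e ⟧
⟦ ren i j e ⟧    = rename i j ⟦ e ⟧

-- Isomorphism of the underlying unlabelled graphs.
_≅_ : ∀ {k} → LabelledGraph k → Graph → Set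
A ≅ G =
  Σ[ φ ∈ (A.V ↔ Vertex G) ]
    (∀ u v → (u A.~ v) ⇔ Graph._~_ G (Inverse.to φ u) (Inverse.to φ v))
  where module A = LabelledGraph A

-- The operations always produce at least one vertex; the empty graph is taken
-- to need no operation, hence no label (clique-width 0).
ConstructibleWith : ℕ → Graph → Set
ConstructibleWith w G = order G ≡ 0 ⊎ (Σ[ e ∈ Expr w ] (⟦ e ⟧ ≅ G))

-- cw(G) ≤ k, where cw(G) is the least w with ConstructibleWith w G: the
-- minimum is at most k exactly when some such w is.
cw_≤_ : Graph → ℕ → Set
cw G ≤ k = ∃[ w ] w ℕ.≤ k × ConstructibleWith w G

BoundedCliqueWidth : Pred Graph (suc 0ℓ) → Set₁
BoundedCliqueWidth C = ∃[ k ] (∀ G → C G → cw G ≤ k)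

{-# OPTIONS --safe #-}
module Submission where

-- Fix a partition of the vertices into boundedly many classes. If the
-- adjacencies between two vertex sets depend on the classes only, expressions
-- for both sets combine into one for the union, with two copies of the classes
-- as labels. A triangle-free and P₁+2P₂-free graph decomposes in this way:
--
-- * Without closed walks of length 5 and 7 it is bipartite. Its bipartite
--   complement is P₅-free, and a vertex with maximal neighbourhood there is
--   adjacent to the whole opposite side of its component.
-- * With a closed 7-walk but no closed 5-walk it is a blow-up of C₇.
-- * Around a 5-cycle the vertices fall into boundedly many classes, where
--   adjacency is determined by the classes outside five tripartite blocks. A
--   block is 2P₂-free between any two parts, and has neither a triangle nor an
--   independent transversal; hence a suitable orientation is acyclic, and
--   adding the vertices in that order attaches each of them uniformly.

open import Level using (0ℓ)
open import Data.Nat as ℕ using (ℕ; _+_; _*_; _^_; _%_; _<_)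
import Data.Nat.Properties as ℕ
open import Data.Nat.DivMod using (m≡m%n+[m/n]*n; m%n<n)
open import Data.Nat.Induction using (<-wellFounded)
open import Data.Bool using (if_then_else_)
open import Data.Fin
  using (Fin; zero; suc; toℕ; fromℕ; fromℕ<; inject₁; splitAt; _↑ˡ_; _↑ʳ_; funToFin; finToFun; combine)
open import Data.Fin.Patterns
open import Data.Fin.Properties
  using (_≟_; any?; all?; toℕ-fromℕ; toℕ-fromℕ<; toℕ-inject₁; ↑ˡ-injective; ↑ʳ-injective;
         splitAt-↑ˡ; splitAt-↑ʳ; finToFun-funToFin; combine-injective)
open import Data.List using (List; []; _∷_; _++_; map; filter; cartesianProduct; allFin; length)
open import Data.List.Properties using (filter-notAll)
open import Data.List.Relation.Unary.Any as Any using (Any; here; there)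
open import Data.List.Relation.Unary.All as All using (All)
open import Data.List.Relation.Unary.All.Properties using (¬All⇒Any¬)
open import Data.List.Membership.Propositional using (_∈_; _∉_; lose; find)
open import Data.List.Membership.Propositional.Properties
  using (∈-++⁺ˡ; ∈-++⁺ʳ; ∈-++⁻; ∈-filter⁺; ∈-filter⁻; ∈-cartesianProduct⁺; ∈-cartesianProduct⁻;
         ∈-map⁺; ∈-map⁻; ∈-allFin)
import Data.List.Membership.DecPropositional as DecMembership
open import Data.Product using (∃-syntax; Σ-syntax; _×_; _,_; proj₁; proj₂; uncurry)
open import Data.Sum as Sum using (_⊎_; inj₁; inj₂; [_,_])
import Data.Sum.Relation.Binary.Pointwise as Pointwise
open import Data.Unit using (tt)
open import Data.Empty using (⊥; ⊥-elim)
open import Function using (_∘_; id; case_of_; Injective; _⇔_; mk⇔; Equivalence; mk↔ₛ′)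
open import Induction.WellFounded using (Acc; acc)
open import Relation.Binary using (Rel; Decidable; Reflexive; Transitive)
open import Relation.Binary.PropositionalEquality
  using (_≡_; _≢_; refl; sym; trans; cong; subst; subst₂)
open import Relation.Nullary
  using (¬_; Dec; yes; no; does; ¬?; _×-dec_; _⊎-dec_; _→-dec_; contradiction)
open import Relation.Nullary.Decidable
  using (True; False; toWitness; toWitnessFalse; decidable-stable; map′)
open import Defs

open Equivalence using (to; from)

-- Expressions for induced subgraphs and how they are combined.

module Construction (G : Graph) where
  open Graph G
  open DecMembership (_≟_ {order}) using (_∈?_)

  -- Labels `g` and edges `E` are free parameters because intermediate stages of a construction
  -- carry scratch labels and only some of the edges of `G`.
  record Realises {K : ℕ} (L : List Vertex) (g : Vertex → Fin K) (E : Rel Vertex 0ℓ)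
                  (e : Expr K) : Set where
    private module e = LabelledGraph ⟦ e ⟧
    field
      vertex     : e.V → Vertex
      injective  : Injective _≡_ _≡_ vertex
      member     : ∀ u → vertex u ∈ L
      surjective : ∀ {x} → x ∈ L → ∃[ u ] vertex u ≡ x
      labels     : ∀ u → e.label u ≡ g (vertex u)
      adjacent   : ∀ u w → (u e.~ w) ⇔ E (vertex u) (vertex w)

  module _ {K : ℕ} where

    realises-cong : ∀ {L g g′ E E′} {e : Expr K} → (∀ {x} → x ∈ L → g x ≡ g′ x) →
                    (∀ {x y} → x ∈ L → y ∈ L → E x y ⇔ E′ x y) →
                    Realises L g E e → Realises L g′ E′ e
    realises-cong g≗g′ E⇔E′ R = record
      { vertex     = vertex
      ; injective  = injective
      ; member     = member
      ; surjective = surjective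
      ; labels     = λ u → trans (labels u) (g≗g′ (member u))
      ; adjacent   = λ u w →
          let q = E⇔E′ (member u) (member w) in
          mk⇔ (to q ∘ to (adjacent u w)) (from (adjacent u w) ∘ from q)
      }
      where open Realises R

    realises-⊕ : ∀ {L₁ L₂ g E} {e₁ e₂ : Expr K} → (∀ {x} → x ∈ L₁ → x ∉ L₂) →
                 (∀ {x y} → x ∈ L₁ → y ∈ L₂ → ¬ E x y × ¬ E y x) →
                 Realises L₁ g E e₁ → Realises L₂ g E e₂ →
                 Realises (L₁ ++ L₂) g E (e₁ ⊕ e₂)
    realises-⊕ {L₁} {L₂} {g} {E} {e₁} {e₂} disjoint separate R₁ R₂ = record
      { vertex     = vertex
      ; injective  = λ {u} {w} → injective u w
      ; member     = [ ∈-++⁺ˡ ∘ R₁.member , ∈-++⁺ʳ L₁ ∘ R₂.member ]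
      ; surjective = λ x∈ →
          [ (λ x∈₁ → let u , eq = R₁.surjective x∈₁ in inj₁ u , eq)
          , (λ x∈₂ → let u , eq = R₂.surjective x∈₂ in inj₂ u , eq)
          ] (∈-++⁻ L₁ x∈)
      ; labels     = λ { (inj₁ u) → R₁.labels u ; (inj₂ u) → R₂.labels u }
      ; adjacent   = adjacent
      }
      where
      module R₁ = Realises R₁
      module R₂ = Realises R₂
      module e = LabelledGraph ⟦ e₁ ⊕ e₂ ⟧

      vertex : e.V → Vertex
      vertex = [ R₁.vertex , R₂.vertex ]

      injective : ∀ u w → vertex u ≡ vertex w → u ≡ w
      injective (inj₁ u) (inj₁ w) eq = cong inj₁ (R₁.injective eq)
      injective (inj₁ u) (inj₂ w) eq =
        contradiction (R₂.member w) (disjoint (subst (_∈ L₁) eq (R₁.member u)))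
      injective (inj₂ u) (inj₁ w) eq =
        contradiction (R₂.member u) (disjoint (subst (_∈ L₁) (sym eq) (R₁.member w)))
      injective (inj₂ u) (inj₂ w) eq = cong inj₂ (R₂.injective eq)

      adjacent : ∀ u w → (u e.~ w) ⇔ E (vertex u) (vertex w)
      adjacent (inj₁ u) (inj₁ w) =
        mk⇔ (λ { (Pointwise.inj₁ p) → to (R₁.adjacent u w) p }) (Pointwise.inj₁ ∘ from (R₁.adjacent u w))
      adjacent (inj₁ u) (inj₂ w) =
        mk⇔ (λ ()) (⊥-elim ∘ proj₁ (separate (R₁.member u) (R₂.member w)))
      adjacent (inj₂ u) (inj₁ w) =
        mk⇔ (λ ()) (⊥-elim ∘ proj₂ (separate (R₁.member w) (R₂.member u)))
      adjacent (inj₂ u) (inj₂ w) =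
        mk⇔ (λ { (Pointwise.inj₂ p) → to (R₂.adjacent u w) p }) (Pointwise.inj₂ ∘ from (R₂.adjacent u w))

    realises-ren : ∀ {L g E} {e : Expr K} i j → Realises L g E e →
                   Realises L (λ x → if does (g x ≟ i) then j else g x) E (ren i j e)
    realises-ren i j R = record
      { vertex     = vertex
      ; injective  = injective
      ; member     = member
      ; surjective = surjective
      ; labels     = λ u → cong (λ l → if does (l ≟ i) then j else l) (labels u)
      ; adjacent   = adjacent
      }
      where open Realises R

    Across : (Vertex → Fin K) → Fin K → Fin K → Rel Vertex 0ℓ
    Across g i j x y = (g x ≡ i × g y ≡ j) ⊎ (g x ≡ j × g y ≡ i)

    realises-join : ∀ {L g E} {e : Expr K} {i j} (i≢j : i ≢ j) → Realises L g E e →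
                    Realises L g (λ x y → E x y ⊎ Across g i j x y) (join i j i≢j e)
    realises-join {g = g} {E = E} {i = i} {j = j} _ R = record
      { vertex     = vertex
      ; injective  = injective
      ; member     = member
      ; surjective = surjective
      ; labels     = labels
      ; adjacent   = λ u w → mk⇔
          [ inj₁ ∘ to (adjacent u w)
          , inj₂ ∘ subst₂ Both (labels u) (labels w)
          ]
          [ inj₁ ∘ from (adjacent u w)
          , inj₂ ∘ subst₂ Both (sym (labels u)) (sym (labels w))
          ]
      }
      where
      open Realises R
      Both : Rel (Fin K) 0ℓ
      Both l m = (l ≡ i × m ≡ j) ⊎ (l ≡ j × m ≡ i)

  module _ {k : ℕ} (class : Vertex → Fin k) where

    module _ {K : ℕ} (α β : Fin k → Fin K) (α-injective : Injective _≡_ _≡_ α)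
             (α≢β : ∀ i j → α i ≢ β j) where

      private
        OneOf : (Vertex → Fin K) → Vertex → Set
        OneOf g x = g x ≡ α (class x) ⊎ g x ≡ β (class x)

        -- The renamings run over the classes of listed vertices instead of over all classes.
        -- Throughout, every vertex carries `α` or `β` of its own class: injectivity of `α` keeps
        -- other classes untouched, and disjointness of the two ranges protects labels that were
        -- already moved.
        relabel-list : ∀ {L g E} {e : Expr K} (xs : List Vertex) →
                       (∀ {y} → y ∈ L → OneOf g y) → Realises L g E e →
                       ∃[ g′ ] ∃[ e′ ] Realises L g′ E e′ ×
                       (∀ {y} → y ∈ L → OneOf g′ y × (y ∈ xs → g′ y ≡ β (class y)))
        relabel-list [] g∈ R = _ , _ , R , λ y∈ → g∈ y∈ , λ ()
        relabel-list {L} (x ∷ xs) g∈ R with relabel-list xs g∈ R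
        ... | g , e , R′ , g∈′ =
          _ , _ , realises-ren (α (class x)) (β (class x)) R′ , λ y∈ → step y∈ , final y∈
          where
          g′ : Vertex → Fin K
          g′ y = if does (g y ≟ α (class x)) then β (class x) else g y

          step : ∀ {y} → y ∈ L → OneOf g′ y
          step {y} y∈ with g y ≟ α (class x) | g∈′ y∈
          ... | yes p | inj₁ q , _ = inj₂ (cong β (α-injective (trans (sym p) q)))
          ... | yes p | inj₂ q , _ = contradiction (trans (sym p) q) (α≢β _ _)
          ... | no  _ | q , _      = q

          final : ∀ {y} → y ∈ L → y ∈ x ∷ xs → g′ y ≡ β (class y)
          final {y} y∈ y∈xs with g y ≟ α (class x) | g∈′ y∈ | y∈xs
          ... | yes p | inj₁ q , _ | _         = cong β (α-injective (trans (sym p) q))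
          ... | yes p | inj₂ q , _ | _         = contradiction (trans (sym p) q) (α≢β _ _)
          ... | no  p | inj₁ q , _ | here refl = contradiction q p
          ... | no  _ | inj₂ q , _ | here refl = q
          ... | no  _ | _ , h      | there y∈  = h y∈

      relabel : ∀ {L g E} {e : Expr K} → (∀ {y} → y ∈ L → OneOf g y) → Realises L g E e →
                ∃[ e′ ] Realises L (β ∘ class) E e′
      relabel {L} g∈ R with relabel-list L g∈ R
      ... | _ , e , R′ , g∈′ =
        e , realises-cong (λ y∈ → proj₂ (g∈′ y∈) y∈) (λ _ _ → mk⇔ id id) R′

      join-list : ∀ {L g E} {e : Expr K} (ps : List (Vertex × Vertex)) → Realises L g E e →
                  ∃[ e′ ] Realises L g
                    (λ x y → E x y ⊎ Any (λ (a , b) → Across g (α (class a)) (β (class b)) x y) ps) e′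
      join-list [] R = _ , realises-cong (λ _ → refl) (λ _ _ → mk⇔ inj₁ [ id , (λ ()) ]) R
      join-list ((a , b) ∷ ps) R with join-list ps R
      ... | _ , R′ = _ , realises-cong (λ _ → refl)
        (λ _ _ → mk⇔ [ [ inj₁ , inj₂ ∘ there ] , inj₂ ∘ here ]
                     [ inj₁ ∘ inj₁ , (λ { (here p) → inj₂ p ; (there p) → inj₁ (inj₂ p) }) ])
        (realises-join (α≢β (class a) (class b)) R′)

    private
      α β : Fin k → Fin (k ℕ.+ k)
      α = _↑ˡ k
      β = k ↑ʳ_

      α≢β : ∀ i j → α i ≢ β j
      α≢β i j eq with trans (sym (splitAt-↑ˡ k i k)) (trans (cong (splitAt k) eq) (splitAt-↑ʳ k k j))
      ... | ()

    -- The subgraph induced by L can be built so that in the end every vertex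
    -- carries its own class as label; a second copy of the classes is available
    -- as scratch labels.
    Buildable : List Vertex → Set
    Buildable L = (∀ {x} → x ∉ L) ⊎ (∃[ e ] Realises L (α ∘ class) _~_ e)

    Homogeneous : Rel (List Vertex) 0ℓ
    Homogeneous L₁ L₂ = ∀ {x x′ y y′} → x ∈ L₁ → x′ ∈ L₁ → y ∈ L₂ → y′ ∈ L₂ →
                        class x ≡ class x′ → class y ≡ class y′ → x ~ y → x′ ~ y′

    buildable-resp : ∀ {L L′} → (∀ {x} → x ∈ L → x ∈ L′) → (∀ {x} → x ∈ L′ → x ∈ L) →
                     Buildable L → Buildable L′
    buildable-resp _ L′⊆L (inj₁ empty) = inj₁ (empty ∘ L′⊆L)
    buildable-resp L⊆L′ L′⊆L (inj₂ (e , R)) = inj₂ (e , record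
      { vertex     = vertex
      ; injective  = injective
      ; member     = L⊆L′ ∘ member
      ; surjective = surjective ∘ L′⊆L
      ; labels     = labels
      ; adjacent   = adjacent
      })
      where open Realises R

    buildable-[_] : ∀ x → Buildable (x ∷ [])
    buildable-[ x ] = inj₂ (new (α (class x)) , record
      { vertex     = λ _ → x
      ; injective  = λ _ → refl
      ; member     = λ _ → here refl
      ; surjective = λ { (here refl) → tt , refl }
      ; labels     = λ _ → refl
      ; adjacent   = λ _ _ → mk⇔ (λ ()) (~-irr refl)
      })

    -- The labels of `L₂` move to the copy `β`, the disjoint union is taken, and each edge `a ~ b`
    -- between the lists triggers a join of `α (class a)` with `β (class b)`. Homogeneity says that
    -- such a join creates edges of `G` only. Finally all labels return to the copy `α`.
    buildable-++ : ∀ {L₁ L₂} → (∀ {x} → x ∈ L₁ → x ∉ L₂) → Homogeneous L₁ L₂ →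
                   Buildable L₁ → Buildable L₂ → Buildable (L₁ ++ L₂)
    buildable-++ {L₁} {L₂} _ _ (inj₁ empty) B =
      buildable-resp (∈-++⁺ʳ L₁) ([ ⊥-elim ∘ empty , id ] ∘ ∈-++⁻ L₁) B
    buildable-++ {L₁} {L₂} _ _ (inj₂ B) (inj₁ empty) =
      buildable-resp ∈-++⁺ˡ ([ id , ⊥-elim ∘ empty ] ∘ ∈-++⁻ L₁) (inj₂ B)
    buildable-++ {L₁} {L₂} disjoint homogeneous (inj₂ (e₁ , R₁)) (inj₂ (e₂ , R₂)) =
      inj₂ (relabel β α (↑ʳ-injective k _ _) (λ i j → α≢β j i ∘ sym) g∈
             (realises-cong (λ _ → refl) E⇔~ (proj₂ joined)))
      where
      g : Vertex → Fin (k ℕ.+ k)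
      g x with x ∈? L₁
      ... | yes _ = α (class x)
      ... | no  _ = β (class x)

      g₁ : ∀ {x} → x ∈ L₁ → α (class x) ≡ g x
      g₁ {x} x∈ with x ∈? L₁
      ... | yes _ = refl
      ... | no  p = contradiction x∈ p

      g₂ : ∀ {x} → x ∈ L₂ → β (class x) ≡ g x
      g₂ {x} x∈ with x ∈? L₁
      ... | yes p = contradiction x∈ (disjoint p)
      ... | no  _ = refl

      g∈ : ∀ {x} → x ∈ L₁ ++ L₂ → g x ≡ β (class x) ⊎ g x ≡ α (class x)
      g∈ = [ inj₂ ∘ sym ∘ g₁ , inj₁ ∘ sym ∘ g₂ ] ∘ ∈-++⁻ L₁

      -- The adjacency right after the disjoint union; the joins contribute the rest.
      E : Rel Vertex 0ℓ
      E x y = x ~ y × ((x ∈ L₁ × y ∈ L₁) ⊎ (x ∈ L₂ × y ∈ L₂))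

      ps : List (Vertex × Vertex)
      ps = filter (uncurry _~?_) (cartesianProduct L₁ L₂)

      R₁′ : Realises L₁ g E e₁
      R₁′ = realises-cong g₁ (λ x∈ y∈ → mk⇔ (λ p → p , inj₁ (x∈ , y∈)) proj₁) R₁

      R₂′ : ∃[ e ] Realises L₂ g E e
      R₂′ = let e , R = relabel α β (↑ˡ-injective k _ _) α≢β (λ _ → inj₁ refl) R₂ in
        e , realises-cong g₂ (λ x∈ y∈ → mk⇔ (λ p → p , inj₂ (x∈ , y∈)) proj₁) R

      joined = join-list α β (↑ˡ-injective k _ _) α≢β ps
        (realises-⊕ disjoint
          (λ x∈ y∈ →
              (λ { (_ , inj₁ (_ , q)) → disjoint q y∈ ; (_ , inj₂ (q , _)) → disjoint x∈ q })
            , (λ { (_ , inj₁ (q , _)) → disjoint q y∈ ; (_ , inj₂ (_ , q)) → disjoint x∈ q }))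
          R₁′ (proj₂ R₂′))

      Crossing : Rel Vertex 0ℓ
      Crossing x y = Any (λ (a , b) → Across g (α (class a)) (β (class b)) x y) ps

      αβ : ∀ {x i} → x ∈ L₂ → g x ≢ α i
      αβ x∈ eq = α≢β _ _ (trans (sym eq) (sym (g₂ x∈)))

      βα : ∀ {x i} → x ∈ L₁ → g x ≢ β i
      βα x∈ eq = α≢β _ _ (trans (g₁ x∈) eq)

      crossing⁻ : ∀ {x y} → x ∈ L₁ ++ L₂ → y ∈ L₁ ++ L₂ → Crossing x y → x ~ y
      crossing⁻ x∈ y∈ q with find q
      ... | (a , b) , ab∈ , r with ∈-filter⁻ (uncurry _~?_) {xs = cartesianProduct L₁ L₂} ab∈
      ... | ab∈′ , a~b with ∈-cartesianProduct⁻ L₁ L₂ ab∈′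
      ... | a∈ , b∈ with ∈-++⁻ L₁ x∈ | ∈-++⁻ L₁ y∈ | r
      ... | inj₁ x∈ | inj₂ y∈ | inj₁ (p , q) = homogeneous a∈ x∈ b∈ y∈
              (↑ˡ-injective k _ _ (trans (sym p) (sym (g₁ x∈))))
              (↑ʳ-injective k _ _ (trans (sym q) (sym (g₂ y∈)))) a~b
      ... | inj₂ x∈ | inj₁ y∈ | inj₂ (p , q) = ~-sym (homogeneous a∈ y∈ b∈ x∈
              (↑ˡ-injective k _ _ (trans (sym q) (sym (g₁ y∈))))
              (↑ʳ-injective k _ _ (trans (sym p) (sym (g₂ x∈)))) a~b)
      ... | inj₂ x∈ | _       | inj₁ (p , _) = contradiction p (αβ x∈)
      ... | inj₁ x∈ | _       | inj₂ (p , _) = contradiction p (βα x∈)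
      ... | _       | inj₁ y∈ | inj₁ (_ , q) = contradiction q (βα y∈)
      ... | _       | inj₂ y∈ | inj₂ (_ , q) = contradiction q (αβ y∈)

      crossing⁺ : ∀ {x y} → x ∈ L₁ → y ∈ L₂ → x ~ y → Crossing x y × Crossing y x
      crossing⁺ x∈ y∈ x~y = lose xy∈ (inj₁ (p , q)) , lose xy∈ (inj₂ (q , p))
        where
        xy∈ = ∈-filter⁺ (uncurry _~?_) (∈-cartesianProduct⁺ x∈ y∈) x~y
        p = sym (g₁ x∈)
        q = sym (g₂ y∈)

      E⇔~ : ∀ {x y} → x ∈ L₁ ++ L₂ → y ∈ L₁ ++ L₂ → (E x y ⊎ Crossing x y) ⇔ x ~ y
      E⇔~ x∈ y∈ = mk⇔ [ proj₁ , crossing⁻ x∈ y∈ ] back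
        where
        back : _ → _
        back x~y with ∈-++⁻ L₁ x∈ | ∈-++⁻ L₁ y∈
        ... | inj₁ p | inj₁ q = inj₁ (x~y , inj₁ (p , q))
        ... | inj₂ p | inj₂ q = inj₁ (x~y , inj₂ (p , q))
        ... | inj₁ p | inj₂ q = inj₂ (proj₁ (crossing⁺ p q x~y))
        ... | inj₂ p | inj₁ q = inj₂ (proj₂ (crossing⁺ q p (~-sym x~y)))

    buildable⇒constructible : Buildable (allFin order) → ConstructibleWith (k ℕ.+ k) G
    buildable⇒constructible (inj₂ (e , R)) = inj₂ (e ,
      mk↔ₛ′ vertex (λ x → proj₁ (surjective (∈-allFin x))) (λ x → proj₂ (surjective (∈-allFin x)))
        (λ u → injective (proj₂ (surjective (∈-allFin (vertex u))))) ,
      adjacent)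
      where open Realises R
    buildable⇒constructible (inj₁ empty) = inj₁ (order≡0 empty)
      where
      order≡0 : ∀ {n} → (∀ {x : Fin n} → x ∉ allFin n) → n ≡ 0
      order≡0 {ℕ.zero}  _     = refl
      order≡0 {ℕ.suc _} empty = ⊥-elim (empty (here refl))

-- Sources in multipartite tournaments.

module Tournament {E R : Set} (role : E → R) {_⇒_ : Rel E 0ℓ} (_⇒?_ : Decidable _⇒_)
  (compare : ∀ x y → role x ≡ role y ⊎ x ⇒ y ⊎ y ⇒ x)
  (⇒⇒≢ : ∀ x y → x ⇒ y → role x ≢ role y)
  (no-3-cycle : ∀ x y z → x ⇒ y → y ⇒ z → ¬ z ⇒ x)
  (no-4-cycle : ∀ x y x′ y′ → role x ≡ role x′ → role y ≡ role y′ →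
                x ⇒ y → y ⇒ x′ → x′ ⇒ y′ → ¬ y′ ⇒ x)
  where

  -- Let `s` be a source of the tail. If the head `v` satisfies `v ⇒ s`, then `v` is a source unless
  -- some `x ⇒ v`; in that case `x` is a source, since any arc into `x` would close a cycle of
  -- length 3 or 4 or contradict the choice of `s`.
  source : ∀ x xs → ∃[ s ] s ∈ x ∷ xs × (∀ {y} → y ∈ x ∷ xs → ¬ y ⇒ s)
  source x [] = x , here refl , λ { (here refl) q → ⇒⇒≢ _ _ q refl }
  source v (w ∷ ws) with source w ws
  ... | s , s∈ , s-source with v ⇒? s
  ... | no ¬v⇒s = s , there s∈ , λ { (here refl) → ¬v⇒s ; (there y∈) → s-source y∈ }
  ... | yes v⇒s with Any.any? (_⇒? v) (w ∷ ws)
  ... | no none = v , here refl , λ { (here refl) q → ⇒⇒≢ _ _ q refl ; (there y∈) q → none (lose y∈ q) }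
  ... | yes some with find some
  ... | x , x∈ , x⇒v = x , there x∈ , λ
    -- The degenerate 4-cycle `v x v x` gives antisymmetry.
    { (here refl) v⇒x → no-4-cycle _ _ _ _ refl refl v⇒x x⇒v v⇒x x⇒v
    ; (there y∈) y⇒x → x-source y∈ y⇒x (compare x s) (compare _ s) (compare _ v)
    }
    where
    -- x has the role of the source s of the rest, since x ⇒ v ⇒ s.
    x-source : ∀ {y} → y ∈ w ∷ ws → y ⇒ x → role x ≡ role s ⊎ x ⇒ s ⊎ s ⇒ x →
               role y ≡ role s ⊎ y ⇒ s ⊎ s ⇒ y → role y ≡ role v ⊎ y ⇒ v ⊎ v ⇒ y → ⊥
    x-source y∈ y⇒x (inj₂ (inj₁ x⇒s)) _ _ = s-source x∈ x⇒s
    x-source y∈ y⇒x (inj₂ (inj₂ s⇒x)) _ _ = no-3-cycle _ _ _ s⇒x x⇒v v⇒s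
    x-source y∈ y⇒x (inj₁ x≈s) (inj₁ y≈s) _ = ⇒⇒≢ _ _ y⇒x (trans y≈s (sym x≈s))
    x-source y∈ y⇒x (inj₁ x≈s) (inj₂ (inj₁ y⇒s)) _ = s-source y∈ y⇒s
    x-source y∈ y⇒x (inj₁ x≈s) (inj₂ (inj₂ s⇒y)) (inj₁ y≈v) =
      no-4-cycle _ _ _ _ (sym x≈s) y≈v s⇒y y⇒x x⇒v v⇒s
    x-source y∈ y⇒x (inj₁ x≈s) (inj₂ (inj₂ s⇒y)) (inj₂ (inj₁ y⇒v)) = no-3-cycle _ _ _ s⇒y y⇒v v⇒s
    x-source y∈ y⇒x (inj₁ x≈s) (inj₂ (inj₂ s⇒y)) (inj₂ (inj₂ v⇒y)) = no-3-cycle _ _ _ v⇒y y⇒x x⇒v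

-- Building tripartite blocks and homogeneous sets.

next : Fin 3 → Fin 3
next zero             = suc zero
next (suc zero)       = suc (suc zero)
next (suc (suc zero)) = zero

next-trichotomy : ∀ r s → r ≡ s ⊎ s ≡ next r ⊎ r ≡ next s
next-trichotomy zero             zero             = inj₁ refl
next-trichotomy zero             (suc zero)       = inj₂ (inj₁ refl)
next-trichotomy zero             (suc (suc zero)) = inj₂ (inj₂ refl)
next-trichotomy (suc zero)       zero             = inj₂ (inj₂ refl)
next-trichotomy (suc zero)       (suc zero)       = inj₁ refl
next-trichotomy (suc zero)       (suc (suc zero)) = inj₂ (inj₁ refl)
next-trichotomy (suc (suc zero)) zero             = inj₂ (inj₁ refl)
next-trichotomy (suc (suc zero)) (suc zero)       = inj₂ (inj₂ refl)
next-trichotomy (suc (suc zero)) (suc (suc zero)) = inj₁ refl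

next≢ : ∀ r → next r ≢ r
next≢ zero             ()
next≢ (suc zero)       ()
next≢ (suc (suc zero)) ()

next²≢ : ∀ r → next (next r) ≢ r
next²≢ zero             ()
next²≢ (suc zero)       ()
next²≢ (suc (suc zero)) ()

module _ (G : Graph) where
  open Graph G
  open Construction G
  open DecMembership (_≟_ {order}) using (_∈?_)

  _≁_ : Rel Vertex 0ℓ
  x ≁ y = ¬ x ~ y

  ≁-sym : ∀ {x y} → x ≁ y → y ≁ x
  ≁-sym x≁y = x≁y ∘ ~-sym

  ≁-stable : ∀ {x y} → ¬ x ≁ y → x ~ y
  ≁-stable = decidable-stable (_ ~? _)

  module _ {k : ℕ} (class : Vertex → Fin k) where

    module Tripartite
      (Part : Fin 3 → Vertex → Set)
      (part-unique : ∀ {r s x} → Part r x → Part s x → r ≡ s)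
      (part-resp : ∀ {r x y} → class x ≡ class y → Part r x → Part r y)
      (independent : ∀ {r x y} → Part r x → Part r y → x ≁ y)
      (2P₂-free : ∀ {r x x′ y y′} → Part r x → Part r x′ → Part (next r) y → Part (next r) y′ →
                  x ~ y → x′ ~ y′ → x ≁ y′ → x′ ≁ y → ⊥)
      (triangle-free : ∀ {x y z} → x ~ y → y ~ z → z ≁ x)
      (no-transversal : ∀ {r x y z} → Part r x → Part (next r) y → Part (next (next r)) z →
                        x ≁ y → y ≁ z → ¬ z ≁ x)
      where

      Element : Set
      Element = ∃[ x ] ∃[ r ] Part r x

      vertexOf : Element → Vertex
      vertexOf (x , _) = x

      role : Element → Fin 3
      role (_ , r , _) = r

      -- x ⇒ y: the vertex x may be added after y, its adjacency to the part of y
      -- being the generic one (none to the next part, all of the previous part).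
      _⇒_ : Rel Element 0ℓ
      x ⇒ y = (role y ≡ next (role x) × vertexOf x ≁ vertexOf y)
            ⊎ (role x ≡ next (role y) × vertexOf x ~ vertexOf y)

      _⇒?_ : Decidable _⇒_
      x ⇒? y = ((role y ≟ next (role x)) ×-dec ¬? (vertexOf x ~? vertexOf y))
        ⊎-dec ((role x ≟ next (role y)) ×-dec (vertexOf x ~? vertexOf y))

      forward : ∀ x y → role y ≡ next (role x) → x ⇒ y → vertexOf x ≁ vertexOf y
      forward x y p (inj₁ (_ , q))      = q
      forward x y p (inj₂ (q , _)) = contradiction (sym (trans q (cong next p))) (next²≢ (role x))

      backward : ∀ x y → role x ≡ next (role y) → x ⇒ y → vertexOf x ~ vertexOf y
      backward x y p (inj₂ (_ , q)) = q
      backward x y p (inj₁ (q , _)) = contradiction (sym (trans q (cong next p))) (next²≢ (role y))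

      compare : ∀ x y → role x ≡ role y ⊎ x ⇒ y ⊎ y ⇒ x
      compare x y with next-trichotomy (role x) (role y) | vertexOf x ~? vertexOf y
      ... | inj₁ eq        | _     = inj₁ eq
      ... | inj₂ (inj₁ eq) | yes p = inj₂ (inj₂ (inj₂ (eq , ~-sym p)))
      ... | inj₂ (inj₁ eq) | no  p = inj₂ (inj₁ (inj₁ (eq , p)))
      ... | inj₂ (inj₂ eq) | yes p = inj₂ (inj₁ (inj₂ (eq , p)))
      ... | inj₂ (inj₂ eq) | no  p = inj₂ (inj₂ (inj₁ (eq , ≁-sym p)))

      ⇒⇒≢ : ∀ x y → x ⇒ y → role x ≢ role y
      ⇒⇒≢ _ y (inj₁ (p , _)) eq = next≢ (role y) (sym (trans p (cong next eq)))
      ⇒⇒≢ x _ (inj₂ (p , _)) eq = next≢ (role x) (sym (trans p (cong next (sym eq))))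

      -- Each arc moves one step forward or backward in the cyclic order of the parts, and three
      -- steps return to the start only if all have the same direction. Three forward arcs form an
      -- independent transversal, three backward ones a triangle.
      no-3-cycle : ∀ x y z → x ⇒ y → y ⇒ z → ¬ z ⇒ x
      no-3-cycle (x , r , p) (y , _ , q) (z , _ , s) (inj₁ (refl , x≁y)) (inj₁ (refl , y≁z)) (inj₁ (_ , z≁x)) =
        no-transversal p q s x≁y y≁z z≁x
      no-3-cycle _ _ _ (inj₂ (_ , x~y)) (inj₂ (_ , y~z)) (inj₂ (_ , z~x)) = triangle-free x~y y~z z~x
      no-3-cycle _ y _ (inj₁ (p , _)) (inj₁ (q , _)) (inj₂ (s , _)) =
        next≢ (role y) (trans (sym q) (trans s (sym p)))
      no-3-cycle x _ _ (inj₁ (p , _)) (inj₂ (q , _)) (inj₁ (s , _)) =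
        next≢ (role x) (trans (sym p) (trans q (sym s)))
      no-3-cycle _ _ z (inj₂ (p , _)) (inj₁ (q , _)) (inj₁ (s , _)) =
        next≢ (role z) (trans (sym s) (trans p (sym q)))
      no-3-cycle _ _ z (inj₁ (p , _)) (inj₂ (q , _)) (inj₂ (s , _)) =
        next≢ (role z) (trans (sym q) (trans p (sym s)))
      no-3-cycle x _ _ (inj₂ (p , _)) (inj₁ (q , _)) (inj₂ (s , _)) =
        next≢ (role x) (trans (sym s) (trans q (sym p)))
      no-3-cycle _ y _ (inj₂ (p , _)) (inj₂ (q , _)) (inj₁ (s , _)) =
        next≢ (role y) (trans (sym p) (trans s (sym q)))

      -- Between two parts the arcs of one direction are non-edges and those of the other are edges,
      -- so an alternating 4-cycle is an induced 2P₂.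
      no-4-cycle : ∀ x y x′ y′ → role x ≡ role x′ → role y ≡ role y′ →
                   x ⇒ y → y ⇒ x′ → x′ ⇒ y′ → ¬ y′ ⇒ x
      no-4-cycle (x , _ , p) (y , _ , q) (x′ , _ , p′) (y′ , _ , q′) refl refl (inj₁ (refl , x≁y)) b c d =
        2P₂-free p p′ q′ q
          (~-sym (backward (y′ , _ , q′) (x , _ , p) refl d))
          (~-sym (backward (y , _ , q) (x′ , _ , p′) refl b))
          x≁y
          (forward (x′ , _ , p′) (y′ , _ , q′) refl c)
      no-4-cycle (x , _ , p) (y , _ , q) (x′ , _ , p′) (y′ , _ , q′) refl refl (inj₂ (refl , x~y)) b c d =
        2P₂-free q q′ p p′ (~-sym x~y)
          (~-sym (backward (x′ , _ , p′) (y′ , _ , q′) refl c))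
          (forward (y , _ , q) (x′ , _ , p′) refl b)
          (forward (y′ , _ , q′) (x , _ , p) refl d)

      open Tournament role _⇒?_ compare ⇒⇒≢ no-3-cycle no-4-cycle

      -- Any exception would be an arc into the source: hence it is complete to the previous part
      -- and has no neighbour in the next one.
      source-homogeneous : ∀ s y y′ → ¬ y ⇒ s → ¬ y′ ⇒ s → class (vertexOf y) ≡ class (vertexOf y′) →
                           vertexOf s ~ vertexOf y → vertexOf s ~ vertexOf y′
      source-homogeneous s@(_ , _ , p) y@(_ , _ , q) y′@(_ , _ , q′) ¬y⇒s ¬y′⇒s eq s~y
        with next-trichotomy (role s) (role y)
      ... | inj₁ refl         = contradiction s~y (independent p q)
      ... | inj₂ (inj₁ next)  = contradiction (inj₂ (next , ~-sym s~y)) ¬y⇒s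
      ... | inj₂ (inj₂ prev)  = ≁-stable (λ s≁y′ → ¬y′⇒s (inj₁ (trans prev (cong next same) , ≁-sym s≁y′)))
        where
        same : role y ≡ role y′
        same = part-unique (part-resp eq q) q′

      -- A source is split off and attached to what remains, which is built recursively.
      buildable : ∀ L → (∀ {x} → x ∈ L → ∃[ r ] Part r x) → Buildable class L
      buildable L parts =
        let es , eq = elements L parts
        in subst (Buildable class) eq (go es (<-wellFounded (length es)))
        where
        elements : ∀ L → (∀ {x} → x ∈ L → ∃[ r ] Part r x) → ∃[ es ] map vertexOf es ≡ L
        elements []      _     = [] , refl
        elements (x ∷ L) parts =
          let es , eq = elements L (parts ∘ there)
          in (x , parts (here refl)) ∷ es , cong (x ∷_) eq

        go : ∀ L → Acc _<_ (length L) → Buildable class (map vertexOf L)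
        go [] _ = inj₁ λ ()
        go L@(e ∷ es) (acc rec) with source e es
        ... | s , s∈ , s-source =
          buildable-resp class ⊆ ⊇
            (buildable-++ class (λ { (here refl) x∈ → proj₂ (rest⁻ x∈) refl }) homogeneous
              (buildable-[_] class (vertexOf s))
              (go rest (rec (filter-notAll other? L (lose s∈ (λ q → q refl))))))
          where
          -- All occurrences of the vertex go at once, so that the two pieces are disjoint even if
          -- `L` has repetitions.
          other? : ∀ x → Dec (vertexOf x ≢ vertexOf s)
          other? x = ¬? (vertexOf x ≟ vertexOf s)

          rest : List Element
          rest = filter other? L

          rest⁻ : ∀ {x} → x ∈ map vertexOf rest →
                  (∃[ y ] y ∈ L × x ≡ vertexOf y) × x ≢ vertexOf s
          rest⁻ x∈ with ∈-map⁻ vertexOf x∈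
          ... | y , y∈ , refl = let y∈L , y≢s = ∈-filter⁻ other? {xs = L} y∈ in (y , y∈L , refl) , y≢s

          ⊆ : ∀ {x} → x ∈ vertexOf s ∷ [] ++ map vertexOf rest → x ∈ map vertexOf L
          ⊆ (here refl) = ∈-map⁺ vertexOf s∈
          ⊆ (there x∈) with rest⁻ x∈
          ... | (_ , y∈ , refl) , _ = ∈-map⁺ vertexOf y∈

          ⊇ : ∀ {x} → x ∈ map vertexOf L → x ∈ vertexOf s ∷ [] ++ map vertexOf rest
          ⊇ x∈ with ∈-map⁻ vertexOf x∈
          ... | y , y∈ , refl with vertexOf y ≟ vertexOf s
          ... | yes eq = here eq
          ... | no  y≢ = there (∈-map⁺ vertexOf (∈-filter⁺ other? y∈ y≢))

          homogeneous : Homogeneous class (vertexOf s ∷ []) (map vertexOf rest)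
          homogeneous (here refl) (here refl) y∈ y′∈ _ eq s~y with rest⁻ y∈ | rest⁻ y′∈
          ... | (y , y∈L , refl) , _ | (y′ , y′∈L , refl) , _ =
            source-homogeneous s y y′ (s-source y∈L) (s-source y′∈L) eq s~y

    homogeneous⇒buildable : ∀ L → Homogeneous class L L → Buildable class L
    homogeneous⇒buildable [] homogeneous = inj₁ λ ()
    homogeneous⇒buildable (x ∷ L) homogeneous with x ∈? L
    ... | yes x∈L = buildable-resp class there (λ { (here refl) → x∈L ; (there y∈) → y∈ })
      (homogeneous⇒buildable L λ p q r s → homogeneous (there p) (there q) (there r) (there s))
    ... | no x∉L = buildable-++ class (λ { (here refl) → x∉L })
      (λ { (here p) (here q) r s → homogeneous (here p) (here q) (there r) (there s) })
      (buildable-[_] class x)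
      (homogeneous⇒buildable L λ p q r s → homogeneous (there p) (there q) (there r) (there s))

-- Classes from decidable predicates, maximal elements, periodic indices.

module Code {A : Set} {m : ℕ} {P : Fin m → A → Set} (P? : ∀ i x → Dec (P i x)) where

  code : A → Fin (2 ^ m)
  code x = funToFin (λ i → if does (P? i x) then 1F else 0F)

  code-resp : ∀ {x y} → code x ≡ code y → ∀ i → P i x → P i y
  code-resp {x} {y} eq i p
    with P? i x | P? i y | trans (sym (finToFun-funToFin _ i)) (trans (cong (λ c → finToFun c i) eq) (finToFun-funToFin _ i))
  ... | no ¬p | _     | _ = contradiction p ¬p
  ... | yes _ | yes q | _ = q

maximal : {A : Set} {_≤_ : Rel A 0ℓ} → Reflexive _≤_ → Transitive _≤_ → Decidable _≤_ →
          ∀ x xs → ∃[ m ] m ∈ x ∷ xs × (∀ {z} → z ∈ x ∷ xs → m ≤ z → z ≤ m)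
maximal ≤-refl ≤-trans _≤?_ x [] = x , here refl , λ { (here refl) p → p }
maximal ≤-refl ≤-trans _≤?_ x (y ∷ ys) with maximal ≤-refl ≤-trans _≤?_ y ys
... | m , m∈ , m-max with m ≤? x
-- Anything above `x` is above `m`, hence below `m` by maximality, hence below `x`.
... | yes m≤x = x , here refl , λ
  { (here refl) p → p ; (there z∈) x≤z → ≤-trans (m-max z∈ (≤-trans m≤x x≤z)) m≤x }
... | no  m≰x = m , there m∈ , λ { (here refl) m≤x → contradiction m≤x m≰x ; (there z∈) → m-max z∈ }

-- Reduces a property of all indices around a cycle to the finitely many residues.
periodic-induction : ∀ {q} (P : ℕ → Set) → (∀ n → P n → P (ℕ.suc q + n)) →
                     (∀ (i : Fin (ℕ.suc q)) → P (toℕ i)) → ∀ n → P n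
periodic-induction {q} P step base n =
  subst P (sym (trans (m≡m%n+[m/n]*n n p) (ℕ.+-comm (n % p) _))) (go (n ℕ./ p))
  where
  p = ℕ.suc q
  go : ∀ k → P (k * p + n % p)
  go ℕ.zero    = subst P (toℕ-fromℕ< (m%n<n n p)) (base (fromℕ< (m%n<n n p)))
  go (ℕ.suc k) = subst P (sym (ℕ.+-assoc p (k * p) (n % p))) (step _ (go k))

module Periodic {A : Set} (q : ℕ) (v : ℕ → A) (periodic : ∀ n → v (ℕ.suc q + n) ≡ v n) where

  -- Stands in for congruence modulo the period. Agreement at all shifts `k` is demanded because the
  -- sets attached to an index `n` refer to several vertices `v (k + n)`.
  _≋_ : Rel ℕ 0ℓ
  m ≋ n = ∀ k → v (k + m) ≡ v (k + n)

  period≋ : ∀ n → (ℕ.suc q + n) ≋ n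
  period≋ n k = trans (cong v rearrange) (periodic (k + n))
    where
    p = ℕ.suc q
    rearrange : k + (p + n) ≡ p + (k + n)
    rearrange = trans (sym (ℕ.+-assoc k p n)) (trans (cong (_+ n) (ℕ.+-comm k p)) (ℕ.+-assoc p k n))

  offset : ∀ n m → ∃[ d ] m ≋ (toℕ {ℕ.suc q} d + n)
  offset ℕ.zero = periodic-induction _
    (λ m (d , eq) → d , λ k → trans (period≋ m k) (eq k))
    (λ i → i , λ k → cong (λ j → v (k + j)) (sym (ℕ.+-identityʳ (toℕ i))))
  offset (ℕ.suc n) m with offset n m
  -- Raising `n` by one lowers the offset by one; offset 0 wraps around to `q`, as `q + suc n` is
  -- one full period more than `n`.
  ... | zero  , eq = fromℕ q , λ k → trans (eq k) (trans (sym (period≋ n k))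
    (cong (λ j → v (k + j)) (trans (sym (ℕ.+-suc q n)) (cong (_+ ℕ.suc n) (sym (toℕ-fromℕ q))))))
  ... | suc d , eq = inject₁ d , λ k → trans (eq k)
    (cong (λ j → v (k + j)) (trans (sym (ℕ.+-suc (toℕ d) n)) (cong (_+ ℕ.suc n) (sym (toℕ-inject₁ d)))))

-- Forbidden configurations.

module _ (G : Graph) where
  open Graph G

  TriangleFree : Set
  TriangleFree = ∀ {x y z} → x ~ y → y ~ z → ¬ z ~ x

  -- Distinctness is not demanded: the listed adjacencies and non-adjacencies already force the five
  -- vertices apart.
  P₁+2P₂-Free : Set
  P₁+2P₂-Free = ∀ {p a b c d} → a ~ b → c ~ d → ¬ p ~ a → ¬ p ~ b → ¬ p ~ c → ¬ p ~ d →
                ¬ a ~ c → ¬ a ~ d → ¬ b ~ c → ¬ b ~ d → ⊥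

  No5Walk : Set
  No5Walk = ∀ {a b c d e} → a ~ b → b ~ c → c ~ d → d ~ e → ¬ e ~ a

  No7Walk : Set
  No7Walk = ∀ {a b c d e f g} → a ~ b → b ~ c → c ~ d → d ~ e → e ~ f → f ~ g → ¬ g ~ a

-- The bipartite case, through the bipartite complement.

module Bipartite (G : Graph) (P₁+2P₂-free : P₁+2P₂-Free G)
  (class : Graph.Vertex G → Fin 2)
  (proper : ∀ {x y} → Graph._~_ G x y → class x ≢ class y) where
  open Graph G
  open Construction G

  ≢⇒≡ : ∀ {i j k : Fin 2} → i ≢ k → j ≢ k → i ≡ j
  ≢⇒≡ {0F} {0F} _ _ = refl
  ≢⇒≡ {1F} {1F} _ _ = refl
  ≢⇒≡ {0F} {1F} {0F} p _ = contradiction refl p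
  ≢⇒≡ {0F} {1F} {1F} _ q = contradiction refl q
  ≢⇒≡ {1F} {0F} {0F} _ q = contradiction refl q
  ≢⇒≡ {1F} {0F} {1F} p _ = contradiction refl p

  ≡⇒≁ : ∀ {x y} → class x ≡ class y → ¬ x ~ y
  ≡⇒≁ eq x~y = proper x~y eq

  -- Adjacency in the bipartite complement.
  _≈_ : Rel Vertex 0ℓ
  x ≈ y = class x ≢ class y × ¬ x ~ y

  _≈?_ : Decidable _≈_
  x ≈? y = ¬? (class x ≟ class y) ×-dec ¬? (x ~? y)

  -- Inclusion of the neighbourhoods of y and z in the bipartite complement.
  _≤[_,_]_ : Vertex → List Vertex → Fin 2 → Vertex → Set
  y ≤[ L , c ] z = All (λ x → class x ≢ c → ¬ x ~ y → ¬ x ~ z) L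

  imply? : ∀ c y z x → Dec (class x ≢ c → ¬ x ~ y → ¬ x ~ z)
  imply? c y z x = ¬? (class x ≟ c) →-dec (¬? (x ~? y) →-dec ¬? (x ~? z))

  maximal-vertex : ∀ x xs → let L = x ∷ xs in
    ∃[ y ] y ∈ L × (∀ {z} → z ∈ L → class z ≡ class y → y ≤[ L , class y ] z → z ≤[ L , class y ] y)
  maximal-vertex x xs =
    let y , y∈ , y-max = maximal {_≤_ = _≤[ x ∷ xs , class x ]_}
          (All.universal (λ _ _ → id) (x ∷ xs))
          (λ p q → All.zipWith (λ (f , g) c → g c ∘ f c) (p , q))
          (λ y z → All.all? (imply? (class x) y z) (x ∷ xs))
          -- Only the vertices on the side of `x` compete.
          x (filter like-x? xs)
        y∈L , y≡x = ⊆ y∈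
    in y , y∈L , λ z∈ z≡y →
         subst (λ c → y ≤[ x ∷ xs , c ] _ → _ ≤[ x ∷ xs , c ] y) (sym y≡x) (y-max (⊇ z∈ (trans z≡y y≡x)))
    where
    like-x? : ∀ y → Dec (class y ≡ class x)
    like-x? y = class y ≟ class x

    ⊆ : ∀ {y} → y ∈ x ∷ filter like-x? xs → y ∈ x ∷ xs × class y ≡ class x
    ⊆ (here refl) = here refl , refl
    ⊆ (there y∈)  = let y∈xs , eq = ∈-filter⁻ like-x? {xs = xs} y∈ in there y∈xs , eq

    ⊇ : ∀ {y} → y ∈ x ∷ xs → class y ≡ class x → y ∈ x ∷ filter like-x? xs
    ⊇ (here refl) _  = here refl
    ⊇ (there y∈)  eq = there (∈-filter⁺ like-x? y∈ eq)

  module Component (L : List Vertex) (y : Vertex) (y∈ : y ∈ L)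
    (y-maximal : ∀ {z} → z ∈ L → class z ≡ class y → y ≤[ L , class y ] z → z ≤[ L , class y ] y)
    where

    -- The component of y in the bipartite complement.
    Near : Vertex → Set
    Near z = z ≈ y ⊎ (class z ≡ class y × Any (λ x → x ≈ y × x ≈ z) L)

    Near? : ∀ z → Dec (Near z)
    Near? z = (z ≈? y) ⊎-dec
      ((class z ≟ class y) ×-dec Any.any? (λ x → (x ≈? y) ×-dec (x ≈? z)) L)

    near? : ∀ z → Dec (z ≢ y × Near z)
    near? z = ¬? (z ≟ y) ×-dec Near? z

    far? : ∀ z → Dec (z ≢ y × ¬ Near z)
    far? z = ¬? (z ≟ y) ×-dec ¬? (Near? z)

    near far : List Vertex
    near = filter near? L
    far  = filter far? L

    near⁻ : ∀ {z} → z ∈ near → z ∈ L × z ≢ y × Near z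
    near⁻ = ∈-filter⁻ near? {xs = L}

    far⁻ : ∀ {z} → z ∈ far → z ∈ L × z ≢ y × ¬ Near z
    far⁻ = ∈-filter⁻ far? {xs = L}

    y-near : ∀ {z} → z ∈ near → ¬ y ~ z
    y-near z∈ with near⁻ z∈
    ... | _ , _ , inj₁ (_ , z≁y)  = z≁y ∘ ~-sym
    ... | _ , _ , inj₂ (z≡y , _) = ≡⇒≁ (sym z≡y)

    -- Suppose `p` and `q` are adjacent in the bipartite complement. If `p` is `y` or a neighbour of
    -- `y` there, `q` would be near. Otherwise `p` is joined to `y` through some `x₁`, while `q` is
    -- not joined to `y`; maximality of `y` gives an `x₀` joined to `y` but not to `p`. Now
    -- `x₀ y x₁ p q` is a P₅ in the complement, so in `G` the edges `x₀ p` and `q y` with `x₁`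
    -- induce P₁+2P₂.
    near-far : ∀ {p q} → p ∈ y ∷ near → q ∈ far → class p ≢ class q → p ~ q
    near-far {p} {q} p∈ q∈ p≢q = ≁-stable G (λ p≁q → absurd p∈ p≁q)
      where
      q∈L = proj₁ (far⁻ q∈)
      q-far = proj₂ (proj₂ (far⁻ q∈))
      absurd : p ∈ y ∷ near → ¬ p ~ q → ⊥
      absurd (here refl) y≁q = q-far (inj₁ (p≢q ∘ sym , y≁q ∘ ~-sym))
      absurd (there p∈) p≁q with near⁻ p∈
      ... | p∈L , _ , inj₁ (p≢y , p≁y) =
        q-far (inj₂ (≢⇒≡ (p≢q ∘ sym) (p≢y ∘ sym) , lose p∈L ((p≢y , p≁y) , (p≢q , p≁q))))
      ... | p∈L , _ , inj₂ (p≡y , via) with find via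
      ... | x₁ , x₁∈ , (x₁≢y , x₁≁y) , (x₁≢p , x₁≁p) =
        let x₀ , x₀∈ , ¬imp = find (¬All⇒Any¬ (imply? (class y) y p) L y≰p)
            x₀≢y = λ (eq : class x₀ ≡ class y) → ¬imp (λ neq → contradiction eq neq)
            x₀≁y = λ (adj : x₀ ~ y) → ¬imp (λ _ nadj → contradiction adj nadj)
            x₀~p = ≁-stable G (λ nadj → ¬imp (λ _ _ → nadj))
        in P₁+2P₂-free x₀~p q~y (≡⇒≁ (≢⇒≡ x₁≢y x₀≢y)) x₁≁p (≡⇒≁ (≢⇒≡ x₁≢y q≢y)) x₁≁y
             (≡⇒≁ (≢⇒≡ x₀≢y q≢y)) x₀≁y p≁q (≡⇒≁ p≡y)
        where
        q≢y : class q ≢ class y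
        q≢y eq = p≢q (trans p≡y (sym eq))
        q~y : q ~ y
        q~y = ≁-stable G (λ q≁y → q-far (inj₁ (q≢y , q≁y)))
        y≰p : ¬ y ≤[ L , class y ] p
        y≰p y≤p = All.lookup (y-maximal p∈L p≡y y≤p) q∈L q≢y (p≁q ∘ ~-sym) q~y

    -- The vertex `y` has no neighbour in `near`, and `y ∷ near` is completely joined to the
    -- opposite side of `far`; both unions are homogeneous.
    assemble : Buildable class near → Buildable class far → Buildable class L
    assemble near-b far-b = buildable-resp class ⊆ ⊇
      (buildable-++ class disjoint homogeneous
        (buildable-++ class (λ { (here refl) z∈ → proj₁ (proj₂ (near⁻ z∈)) refl })
          (λ { (here refl) _ z∈ _ _ _ y~z → contradiction y~z (y-near z∈) })
          (buildable-[_] class y) near-b)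
        far-b)
      where
      disjoint : ∀ {x} → x ∈ y ∷ near → x ∉ far
      disjoint (here refl) q∈ = proj₁ (proj₂ (far⁻ q∈)) refl
      disjoint (there p∈)  q∈ = proj₂ (proj₂ (far⁻ q∈)) (proj₂ (proj₂ (near⁻ p∈)))

      homogeneous : Homogeneous class (y ∷ near) far
      homogeneous _ x′∈ _ z′∈ eqx eqz x~z =
        near-far x′∈ z′∈ (λ eq → proper x~z (trans eqx (trans eq (sym eqz))))

      ⊆ : ∀ {x} → x ∈ (y ∷ near) ++ far → x ∈ L
      ⊆ x∈ with ∈-++⁻ (y ∷ near) x∈
      ... | inj₁ (here refl) = y∈
      ... | inj₁ (there p∈)  = proj₁ (near⁻ p∈)
      ... | inj₂ q∈          = proj₁ (far⁻ q∈)

      ⊇ : ∀ {x} → x ∈ L → x ∈ (y ∷ near) ++ far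
      ⊇ {x} x∈ with x ≟ y | Near? x
      ... | yes eq | _     = here eq
      ... | no neq | yes p = there (∈-++⁺ˡ (∈-filter⁺ near? x∈ (neq , p)))
      ... | no neq | no ¬p = ∈-++⁺ʳ (y ∷ near) (∈-filter⁺ far? x∈ (neq , ¬p))

    near-shorter : length near < length L
    near-shorter = filter-notAll near? L (lose (y∈) (λ p → proj₁ p refl))

    far-shorter : length far < length L
    far-shorter = filter-notAll far? L (lose (y∈) (λ p → proj₁ p refl))

  buildable : ∀ L → Buildable class L
  buildable L = go L (<-wellFounded (length L))
    where
    go : ∀ L → Acc _<_ (length L) → Buildable class L
    go []       _         = inj₁ λ ()
    go (x ∷ xs) (acc rec) = assemble (go near (rec near-shorter)) (go far (rec far-shorter))
      where
      m = maximal-vertex x xs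
      open Component (x ∷ xs) (proj₁ m) (proj₁ (proj₂ m)) (proj₂ (proj₂ m))

-- A two-colouring in the absence of closed 5-walks and 7-walks.

module Colouring (G : Graph) (triangle-free : TriangleFree G) (P₁+2P₂-free : P₁+2P₂-Free G)
  (no5 : No5Walk G) (no7 : No7Walk G) where
  open Graph G

  TwoColouring : Set
  TwoColouring = Σ[ class ∈ (Vertex → Fin 2) ] (∀ {x y} → x ~ y → class x ≢ class y)

  two-colouring : {White : Vertex → Set} → (∀ y → Dec (White y)) →
                  (∀ {x y} → x ~ y → White x → ¬ White y) →
                  (∀ {x y} → x ~ y → ¬ White x → ¬ ¬ White y) → TwoColouring
  two-colouring {White} white? white black = class , proper
    where
    class : Vertex → Fin 2
    class y = if does (white? y) then 0F else 1F

    proper : ∀ {x y} → x ~ y → class x ≢ class y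
    proper {x} {y} x~y eq with white? x | white? y | eq
    ... | yes p | yes q | _ = white x~y p q
    ... | no  p | no  q | _ = black x~y p q

  module _ {a b : Vertex} (a~b : a ~ b) where

    Rest : Vertex → Set
    Rest y = (¬ y ~ a) × (¬ y ~ b)

    -- The ends of walks of length two from `b`, respectively `a`. In a two-colouring they have the
    -- colour of `b`, respectively `a`; taking `s` to be `a` or `b` shows that all neighbours of
    -- `a`, respectively `b`, are included.
    NearA NearB : Vertex → Set
    NearA y = ∃[ s ] s ~ b × s ~ y
    NearB y = ∃[ s ] s ~ a × s ~ y

    Rest? : ∀ y → Dec (Rest y)
    Rest? y = ¬? (y ~? a) ×-dec ¬? (y ~? b)

    NearA? : ∀ y → Dec (NearA y)
    NearA? y = any? λ s → (s ~? b) ×-dec (s ~? y)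

    NearB? : ∀ y → Dec (NearB y)
    NearB? y = any? λ s → (s ~? a) ×-dec (s ~? y)

    module _ {Q : Vertex → Set} (Q? : ∀ y → Dec (Q y))
      (nearB⇒¬Q : ∀ {x y} → Rest x → NearB x → Rest y → x ~ y → ¬ Q y)
      (Q⇒¬nearA : ∀ {y} → Rest y → Q y → ¬ NearA y)
      (Q-independent : ∀ {x y} → Rest x → Rest y → x ~ y → Q x → ¬ Q y)
      (¬Q-independent : ∀ {x y} → Rest x → Rest y → x ~ y → ¬ Q x → ¬ ¬ Q y)
      where

      -- The side of `a`: forced on `NearB`, while `Q` selects further vertices of the rest.
      White : Vertex → Set
      White y = NearB y ⊎ (Rest y × Q y)

      -- Two adjacent vertices of `NearB` close a 5-walk through `a`. If only `x` is known to be in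
      -- `NearB`, then `x ~ a` gives a triangle and `x ~ b` puts `y` into `NearA`; otherwise `x`
      -- belongs to the rest and the hypotheses on `Q` apply.
      white-independent : ∀ {x y} → x ~ y → White x → ¬ White y
      white-independent x~y (inj₁ (s , s~a , s~x)) (inj₁ (t , t~a , t~y)) =
        no5 x~y (~-sym t~y) t~a (~-sym s~a) s~x
      white-independent {x} x~y (inj₁ (s , s~a , s~x)) (inj₂ (y-rest , Qy)) with x ~? a | x ~? b
      ... | yes x~a | _       = triangle-free s~x x~a (~-sym s~a)
      ... | no  _   | yes x~b = Q⇒¬nearA y-rest Qy (x , x~b , x~y)
      ... | no  x≁a | no  x≁b = nearB⇒¬Q (x≁a , x≁b) (s , s~a , s~x) y-rest x~y Qy
      white-independent x~y p@(inj₂ _) q@(inj₁ _) = white-independent (~-sym x~y) q p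
      white-independent x~y (inj₂ (x-rest , Qx)) (inj₂ (y-rest , Qy)) =
        Q-independent x-rest y-rest x~y Qx Qy

      rest : ∀ {x y} → x ~ y → ¬ White x → ¬ White y → Rest x
      rest {x} x~y ¬Wx ¬Wy =
        (λ x~a → ¬Wy (inj₁ (x , x~a , x~y))) ,
        (λ x~b → ¬Wx (inj₁ (b , ~-sym a~b , ~-sym x~b)))

      coloured : TwoColouring
      coloured = two-colouring (λ y → NearB? y ⊎-dec (Rest? y ×-dec Q? y)) white-independent
        λ x~y ¬Wx ¬Wy →
          let x-rest = rest x~y ¬Wx ¬Wy
              y-rest = rest (~-sym x~y) ¬Wy ¬Wx
          in ¬Q-independent x-rest y-rest x~y (λ q → ¬Wx (inj₂ (x-rest , q))) (λ q → ¬Wy (inj₂ (y-rest , q)))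

    -- An obstruction to giving `c` the colour of `b` and `d` that of `a`: some `z` in the rest
    -- receives one colour from its neighbour `c` or `d` and the other from `NearA` or `NearB`.
    Bad : Vertex → Vertex → Set
    Bad c d = ∃[ z ] Rest z × ((z ~ c × NearA z) ⊎ (z ~ d × NearB z))

    Bad? : ∀ c d → Dec (Bad c d)
    Bad? c d = any? λ z → Rest? z ×-dec (((z ~? c) ×-dec NearA? z) ⊎-dec ((z ~? d) ×-dec NearB? z))

    -- Obstructions to both assignments join up to a closed 7-walk, passing through the edge `c d`
    -- or the edge `a b`.
    bad-twice : ∀ {c d} → c ~ d → Bad c d → ¬ Bad d c
    bad-twice c~d (z , _ , inj₁ (z~c , s , s~b , s~z)) (z′ , _ , inj₁ (z′~d , s′ , s′~b , s′~z′)) =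
      no7 (~-sym z~c) (~-sym s~z) s~b (~-sym s′~b) s′~z′ z′~d (~-sym c~d)
    bad-twice c~d (z , _ , inj₁ (z~c , s , s~b , s~z)) (z′ , _ , inj₂ (z′~c , s′ , s′~a , s′~z′)) =
      no7 (~-sym z~c) (~-sym s~z) s~b (~-sym a~b) (~-sym s′~a) s′~z′ z′~c
    bad-twice c~d (z , _ , inj₂ (z~d , s , s~a , s~z)) (z′ , _ , inj₁ (z′~d , s′ , s′~b , s′~z′)) =
      no7 (~-sym z~d) (~-sym s~z) s~a a~b (~-sym s′~b) s′~z′ z′~d
    bad-twice c~d (z , _ , inj₂ (z~d , s , s~a , s~z)) (z′ , _ , inj₂ (z′~c , s′ , s′~a , s′~z′)) =
      no7 (~-sym z~d) (~-sym s~z) s~a (~-sym s′~a) s′~z′ z′~c c~d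

    -- An edge c d of the rest dominates the rest, as a b c d and a vertex
    -- adjacent to none of them would induce P₁+2P₂.
    not-bad⇒coloured : ∀ {c d} → Rest c → Rest d → c ~ d → ¬ Bad c d → TwoColouring
    not-bad⇒coloured {c} {d} (c≁a , c≁b) (d≁a , d≁b) c~d good = coloured (λ y → y ~? c)
      (λ {x} {y} x-rest x-nearB _ x~y y~c → case dominated x-rest of λ
        { (inj₁ x~c) → triangle-free x~y y~c (~-sym x~c)
        ; (inj₂ x~d) → good (x , x-rest , inj₂ (x~d , x-nearB)) })
      (λ {y} y-rest y~c y-nearA → good (y , y-rest , inj₁ (y~c , y-nearA)))
      (λ _ _ x~y x~c y~c → triangle-free x~y y~c (~-sym x~c))
      (λ x-rest y-rest x~y x≁c y≁c → triangle-free x~y (other y-rest y≁c) (~-sym (other x-rest x≁c)))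
      where
      dominated : ∀ {x} → Rest x → x ~ c ⊎ x ~ d
      dominated {x} (x≁a , x≁b) with x ~? c | x ~? d
      ... | yes p | _     = inj₁ p
      ... | no  _ | yes q = inj₂ q
      ... | no  p | no  q = contradiction c~d λ c~d →
        P₁+2P₂-free a~b c~d x≁a x≁b p q (c≁a ∘ ~-sym) (d≁a ∘ ~-sym) (c≁b ∘ ~-sym) (d≁b ∘ ~-sym)

      other : ∀ {x} → Rest x → ¬ x ~ c → x ~ d
      other x-rest x≁c = [ (λ x~c → contradiction x~c x≁c) , id ] (dominated x-rest)

    edge⇒coloured : TwoColouring
    edge⇒coloured with any? (λ c → any? λ d → (Rest? c ×-dec Rest? d) ×-dec (c ~? d))
    -- The rest is independent, so no vertex of it has to be made white by `Q`.
    ... | no none = coloured {Q = λ _ → ⊥} (λ _ → no id) (λ _ _ _ _ ()) (λ _ ()) (λ _ _ _ ())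
      λ {x} {y} x-rest y-rest x~y _ _ → none (x , y , (x-rest , y-rest) , x~y)
    ... | yes (c , d , (c-rest , d-rest) , c~d) with Bad? c d | Bad? d c
    ... | no good | _        = not-bad⇒coloured c-rest d-rest c~d good
    ... | yes _   | no good  = not-bad⇒coloured d-rest c-rest (~-sym c~d) good
    ... | yes bad | yes bad′ = contradiction bad′ (bad-twice c~d bad)

  bipartite : TwoColouring
  bipartite with any? (λ a → any? λ b → a ~? b)
  ... | yes (_ , _ , a~b) = edge⇒coloured a~b
  ... | no none = (λ _ → 0F) , λ {x} {y} x~y _ → none (x , y , x~y)

-- Blow-ups of C₇.

module SevenCycle (G : Graph) (triangle-free : TriangleFree G) (P₁+2P₂-free : P₁+2P₂-Free G) (no5 : No5Walk G)
  {v₀ v₁ v₂ v₃ v₄ v₅ v₆ : Graph.Vertex G}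
  (e₀ : Graph._~_ G v₀ v₁) (e₁ : Graph._~_ G v₁ v₂) (e₂ : Graph._~_ G v₂ v₃)
  (e₃ : Graph._~_ G v₃ v₄) (e₄ : Graph._~_ G v₄ v₅) (e₅ : Graph._~_ G v₅ v₆)
  (e₆ : Graph._~_ G v₆ v₀)
  where
  open Graph G
  open Construction G

  -- Periodic extension makes rotation a shift of the index, and `v (7 + n)` computes to `v n`.
  v : ℕ → Vertex
  v 0 = v₀
  v 1 = v₁
  v 2 = v₂
  v 3 = v₃
  v 4 = v₄
  v 5 = v₅
  v 6 = v₆
  v (ℕ.suc (ℕ.suc (ℕ.suc (ℕ.suc (ℕ.suc (ℕ.suc (ℕ.suc n))))))) = v n

  edge : ∀ n → v n ~ v (1 + n)
  edge 0 = e₀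
  edge 1 = e₁
  edge 2 = e₂
  edge 3 = e₃
  edge 4 = e₄
  edge 5 = e₅
  edge 6 = e₆
  edge (ℕ.suc (ℕ.suc (ℕ.suc (ℕ.suc (ℕ.suc (ℕ.suc (ℕ.suc n))))))) = edge n

  open Periodic 6 v (λ _ → refl)

  chord₂ : ∀ n → ¬ v n ~ v (2 + n)
  chord₂ n p = triangle-free (edge n) (edge (1 + n)) (~-sym p)

  chord₃ : ∀ n → ¬ v n ~ v (3 + n)
  chord₃ n = no5 (edge (3 + n)) (edge (4 + n)) (edge (5 + n)) (edge (6 + n))

  common : ∀ {x y z} → x ~ z → y ~ z → ¬ x ~ y
  common x~z y~z x~y = triangle-free x~y y~z (~-sym x~z)

  -- The vertices that can replace v (1 + n) in the cycle.
  U : ℕ → Vertex → Set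
  U n y = y ~ v n × y ~ v (2 + n)

  U-cong : ∀ m n {y} → m ≋ n → U m y → U n y
  U-cong _ _ {y} eq (p , q) = subst (y ~_) (eq 0) p , subst (y ~_) (eq 2) q

  touches : ∀ y → ∃[ n ] y ~ v n
  touches y with any? (λ (i : Fin 7) → y ~? v (toℕ i))
  ... | yes (i , p) = toℕ i , p
  ... | no none = ⊥-elim (P₁+2P₂-free (edge 0) (edge 3)
    (λ p → none (0F , p)) (λ p → none (1F , p)) (λ p → none (3F , p)) (λ p → none (4F , p))
    (chord₃ 0) (chord₃ 4 ∘ ~-sym) (chord₂ 1) (chord₃ 1))

  -- A neighbour `v n` exists. If `y` misses both cycle vertices at distance two from it, then `y`
  -- is isolated from the edges at `2 + n` and `5 + n`, which gives P₁+2P₂.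
  in-U : ∀ y → ∃[ n ] U n y
  in-U y with touches y
  ... | n , p with y ~? v (2 + n) | y ~? v (5 + n)
  ... | yes q | _     = n , p , q
  ... | no  _ | yes q = 5 + n , q , p
  ... | no ¬q | no ¬r = ⊥-elim (P₁+2P₂-free (edge (2 + n)) (edge (5 + n))
    ¬q (no5 p (edge n) (edge (1 + n)) (edge (2 + n)) ∘ ~-sym)
    ¬r (λ s → common p (edge (6 + n)) s)
    (chord₃ (2 + n)) (chord₃ (6 + n) ∘ ~-sym) (chord₂ (3 + n)) (chord₃ (3 + n)))

  -- If `x ≁ y`, then `v (5 + n)` and the edges from `x` to `v n` and from `y` to `v (3 + n)` induce
  -- P₁+2P₂.
  U₀-U₁ : ∀ n {x y} → U n x → U (1 + n) y → x ~ y
  U₀-U₁ n {x} {y} (x~0 , x~2) (y~1 , y~3) = ≁-stable G λ x≁y → P₁+2P₂-free x~0 y~3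
    (λ p → no5 x~2 (edge (2 + n)) (edge (3 + n)) (edge (4 + n)) (p))
    (chord₂ (5 + n))
    (λ p → no5 (~-sym p) (edge (5 + n)) (edge (6 + n)) (edge n) (~-sym y~1))
    (chord₂ (3 + n) ∘ ~-sym)
    x≁y (common x~2 (~-sym (edge (2 + n)))) (common (edge n) y~1) (chord₃ n)

  U₀-U₃ : ∀ n {x y} → U n x → U (3 + n) y → ¬ x ~ y
  U₀-U₃ n (x~0 , _) (_ , y~5) x~y = no5 x~y y~5 (edge (5 + n)) (edge (6 + n)) (~-sym x~0)

  blow-up : ∀ d n {x x′ y y′} → U n x → U n x′ → U (toℕ {7} d + n) y → U (toℕ {7} d + n) y′ → x ~ y → x′ ~ y′
  blow-up 0F n (x~ , _) _ (y~ , _) _ x~y = ⊥-elim (common x~ y~ x~y)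
  blow-up 1F n _ Ux′ _ Uy′ _ = U₀-U₁ n Ux′ Uy′
  blow-up 2F n (_ , x~) _ (y~ , _) _ x~y = ⊥-elim (common x~ y~ x~y)
  blow-up 3F n Ux _ Uy _ x~y = ⊥-elim (U₀-U₃ n Ux Uy x~y)
  -- Offset 4 is -3 modulo 7, so `x` and `y` exchange roles; likewise offset 6 is -1.
  blow-up 4F n Ux _ Uy _ x~y = ⊥-elim (U₀-U₃ (4 + n) Uy Ux (~-sym x~y))
  blow-up 5F n (x~ , _) _ (_ , y~) _ x~y = ⊥-elim (common x~ y~ x~y)
  blow-up 6F n _ Ux′ _ Uy′ _ = ~-sym (U₀-U₁ (6 + n) Uy′ Ux′)

  open Code (λ (i : Fin 7) x → x ~? v (toℕ i)) public

  U-resp : ∀ {x y} → code x ≡ code y → ∀ n → U n x → U n y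
  U-resp {x} {y} eq n (p , q) = adjacent n p , adjacent (2 + n) q
    where
    adjacent : ∀ n → x ~ v n → y ~ v n
    adjacent = periodic-induction {6} _ (λ _ → id) (code-resp eq)

  buildable : ∀ L → Buildable code L
  buildable L = homogeneous⇒buildable G code L λ { {x} {_} {y} _ _ _ _ eqx eqy x~y →
    let n , Ux = in-U x
        m , Uy = in-U y
        d , m≋ = offset n m
        n′     = toℕ d + n
        Uy′    = U-cong m n′ m≋ Uy
    in blow-up d n Ux (U-resp eqx n Ux) Uy′ (U-resp eqy n′ Uy′) x~y }

-- Vertices around a 5-cycle.

module FiveCycle (G : Graph) (triangle-free : TriangleFree G) (P₁+2P₂-free : P₁+2P₂-Free G)
  {v₀ v₁ v₂ v₃ v₄ : Graph.Vertex G}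
  (e₀ : Graph._~_ G v₀ v₁) (e₁ : Graph._~_ G v₁ v₂) (e₂ : Graph._~_ G v₂ v₃)
  (e₃ : Graph._~_ G v₃ v₄) (e₄ : Graph._~_ G v₄ v₀)
  where
  open Graph G
  open Construction G

  v : ℕ → Vertex
  v 0 = v₀
  v 1 = v₁
  v 2 = v₂
  v 3 = v₃
  v 4 = v₄
  v (ℕ.suc (ℕ.suc (ℕ.suc (ℕ.suc (ℕ.suc n))))) = v n

  edge : ∀ n → v n ~ v (1 + n)
  edge 0 = e₀
  edge 1 = e₁
  edge 2 = e₂
  edge 3 = e₃
  edge 4 = e₄
  edge (ℕ.suc (ℕ.suc (ℕ.suc (ℕ.suc (ℕ.suc n))))) = edge n

  open Periodic 4 v (λ _ → refl)

  common : ∀ {x y z} → x ~ z → y ~ z → ¬ x ~ y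
  common x~z y~z x~y = triangle-free x~y y~z (~-sym x~z)

  ¬-sym : ∀ {x y} → ¬ x ~ y → ¬ y ~ x
  ¬-sym = ≁-sym G

  stable : ∀ {x y} → ¬ ¬ x ~ y → x ~ y
  stable = ≁-stable G

  chord₂ : ∀ n → ¬ v n ~ v (2 + n)
  chord₂ n p = triangle-free (edge n) (edge (1 + n)) (~-sym p)

  chord₃ : ∀ n → ¬ v n ~ v (3 + n)
  chord₃ n = ¬-sym (chord₂ (3 + n))

  -- W n and U n are the vertices whose only neighbours on the cycle are v n,
  -- respectively v (n − 1) and v (n + 1); Z consists of those without any.
  -- F tells in which direction a vertex of U n deviates from the adjacencies
  -- of v n: never towards U (n − 1) and W (n + 2) if F holds, and never towards
  -- U (n + 1) and W (n − 2) otherwise.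
  U W F : ℕ → Vertex → Set
  U n y = y ~ v (4 + n) × y ~ v (1 + n)
  W n y = y ~ v n × ¬ y ~ v (2 + n) × ¬ y ~ v (3 + n)
  F n y = ∃[ t ] ((U (1 + n) t × ¬ t ~ y) ⊎ (W (3 + n) t × t ~ y))

  Z TouchesZ : Vertex → Set
  Z y = ∀ n → ¬ y ~ v n
  TouchesZ y = ∃[ z ] Z z × z ~ y

  U? : ∀ n y → Dec (U n y)
  U? n y = (y ~? v (4 + n)) ×-dec (y ~? v (1 + n))

  W? : ∀ n y → Dec (W n y)
  W? n y = (y ~? v n) ×-dec (¬? (y ~? v (2 + n)) ×-dec ¬? (y ~? v (3 + n)))

  F? : ∀ n y → Dec (F n y)
  F? n y = any? λ t → (U? (1 + n) t ×-dec ¬? (t ~? y)) ⊎-dec (W? (3 + n) t ×-dec (t ~? y))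

  Z? : ∀ y → Dec (Z y)
  Z? y = map′ (periodic-induction {4} _ (λ _ → id)) (λ z i → z (toℕ i))
    (all? λ i → ¬? (y ~? v (toℕ i)))

  TouchesZ? : ∀ y → Dec (TouchesZ y)
  TouchesZ? y = any? λ z → Z? z ×-dec (z ~? y)

  U-cong : ∀ m n {y} → m ≋ n → U m y → U n y
  U-cong _ _ {y} eq (p , q) = subst (y ~_) (eq 4) p , subst (y ~_) (eq 1) q

  W-cong : ∀ m n {y} → m ≋ n → W m y → W n y
  W-cong _ _ {y} eq (p , q , r) =
    subst (y ~_) (eq 0) p , subst (λ z → ¬ y ~ z) (eq 2) q , subst (λ z → ¬ y ~ z) (eq 3) r

  data Kind (y : Vertex) : Set where
    isZ : Z y → Kind y
    isW : ∀ n → W n y → Kind y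
    isU : ∀ n → U n y → Kind y

  kind : ∀ y → Kind y
  kind y with any? (λ (i : Fin 5) → y ~? v (toℕ i))
  ... | no none = isZ (periodic-induction {4} _ (λ _ → id) (λ i p → none (i , p)))
  ... | yes (i , p) with y ~? v (2 + toℕ i) | y ~? v (3 + toℕ i)
  -- The index of `U` is the midpoint of the two neighbours: `1 + i`, or `4 + i` standing for
  -- `i − 1`.
  ... | yes q | _     = isU (1 + toℕ i) (p , q)
  ... | no  _ | yes r = isU (4 + toℕ i) (r , p)
  ... | no ¬q | no ¬r = isW (toℕ i) (p , ¬q , ¬r)

  -- Adjacencies between the kinds of vertices.

  U≁₀ : ∀ n {y} → U n y → ¬ y ~ v n
  U≁₀ n (_ , p) = common p (edge n)

  U≁₂ : ∀ n {y} → U n y → ¬ y ~ v (2 + n)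
  U≁₂ n (_ , p) = common p (~-sym (edge (1 + n)))

  U≁₃ : ∀ n {y} → U n y → ¬ y ~ v (3 + n)
  U≁₃ n (p , _) = common p (edge (3 + n))

  W≁₁ : ∀ n {y} → W n y → ¬ y ~ v (1 + n)
  W≁₁ n (p , _) = common p (~-sym (edge n))

  W≁₄ : ∀ n {y} → W n y → ¬ y ~ v (4 + n)
  W≁₄ n (p , _) = common p (edge (4 + n))

  Z-Z : ∀ {x y} → Z x → Z y → ¬ x ~ y
  Z-Z Zx Zy x~y = P₁+2P₂-free x~y (edge 0) (¬-sym (Zx 3)) (¬-sym (Zy 3))
    (¬-sym (chord₃ 0)) (¬-sym (chord₂ 1)) (Zx 0) (Zx 1) (Zy 0) (Zy 1)

  Z-W : ∀ n {z w} → Z z → W n w → z ~ w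
  Z-W n Zz (w₀ , w₂ , w₃) = stable λ z≁w → P₁+2P₂-free w₀ (edge (2 + n))
    z≁w (Zz n) (Zz (2 + n)) (Zz (3 + n)) w₂ w₃ (chord₂ n) (chord₃ n)

  -- Otherwise `z u` and a cycle edge, with `z′` isolated, induce P₁+2P₂. So a vertex of `U n` sees
  -- all of `Z` or nothing of it, and the single bit `TouchesZ` records which.
  Z-U-twins : ∀ n {z z′ u} → Z z → Z z′ → U n u → z ~ u → z′ ~ u
  Z-U-twins n Zz Zz′ Uu z~u = stable λ z′≁u → P₁+2P₂-free z~u (edge (2 + n))
    (Z-Z Zz′ Zz) z′≁u (Zz′ (2 + n)) (Zz′ (3 + n)) (Zz (2 + n)) (Zz (3 + n)) (U≁₂ n Uu) (U≁₃ n Uu)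

  W₀-W₀ : ∀ n {x y} → W n x → W n y → ¬ x ~ y
  W₀-W₀ n (p , _) (q , _) = common p q

  W₀-W₁ : ∀ n {x y} → W n x → W (1 + n) y → x ~ y
  W₀-W₁ n (x₀ , x₂ , x₃) Wy@(_ , y₃ , _) = stable λ x≁y → P₁+2P₂-free x₀ (edge (2 + n))
    (¬-sym x≁y) (W≁₄ (1 + n) Wy) (W≁₁ (1 + n) Wy) y₃ x₂ x₃ (chord₂ n) (chord₃ n)

  W₀-W₂ : ∀ n {x y} → W n x → W (2 + n) y → ¬ x ~ y
  W₀-W₂ n Wx@(_ , _ , x₃) Wy@(_ , y₄ , _) x~y = P₁+2P₂-free x~y (edge (3 + n))
    (¬-sym (W≁₁ n Wx)) (¬-sym (W≁₄ (2 + n) Wy)) (chord₂ (1 + n)) (chord₃ (1 + n))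
    x₃ (W≁₄ n Wx) (W≁₁ (2 + n) Wy) y₄

  W₀-U₀ : ∀ n {w u} → W n w → U n u → w ~ u
  W₀-U₀ n (w₀ , w₂ , w₃) Uu = stable λ w≁u → P₁+2P₂-free w₀ (edge (2 + n))
    (¬-sym w≁u) (U≁₀ n Uu) (U≁₂ n Uu) (U≁₃ n Uu) w₂ w₃ (chord₂ n) (chord₃ n)

  W₀-U₁ : ∀ n {w u} → W n w → U (1 + n) u → ¬ w ~ u
  W₀-U₁ n (p , _) (q , _) = common p q

  W₀-U₄ : ∀ n {w u} → W n w → U (4 + n) u → ¬ w ~ u
  W₀-U₄ n (p , _) (_ , q) = common p q

  U₀-U₀ : ∀ n {x y} → U n x → U n y → ¬ x ~ y
  U₀-U₀ n (p , _) (q , _) = common p q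

  U₀-U₂ : ∀ n {x y} → U n x → U (2 + n) y → ¬ x ~ y
  U₀-U₂ n (_ , p) (q , _) = common p q

  -- One missing edge between consecutive sets `U` rules out deviations on the other side, because
  -- the two non-adjacent vertices supply the independent ends of two edges.
  module _ (n : ℕ) {u x : Vertex} (Uu : U n u) (Ux : U (1 + n) x) (u≁x : ¬ u ~ x) where

    private
      u₄ = proj₁ Uu
      u₁ = proj₂ Uu
      x₀ = proj₁ Ux
      x₂ = proj₂ Ux

    ≁⇒complete₄ : ∀ {t} → U (4 + n) t → t ~ u
    ≁⇒complete₄ Ut = stable λ t≁u → P₁+2P₂-free u₄ x₂
      t≁u (U≁₀ (4 + n) Ut) (U₀-U₂ (4 + n) Ut Ux) (U≁₃ (4 + n) Ut)
      u≁x (U≁₂ n Uu) (¬-sym (U≁₃ (1 + n) Ux)) (¬-sym (chord₂ (2 + n)))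

    ≁⇒W₄-anticomplete : ∀ {w} → W (4 + n) w → ¬ w ~ x
    ≁⇒W₄-anticomplete Ww@(_ , w₁ , _) w~x = P₁+2P₂-free u₁ w~x
      (¬-sym (U≁₃ n Uu)) (¬-sym (chord₂ (1 + n))) (¬-sym (W≁₄ (4 + n) Ww)) (¬-sym (U≁₂ (1 + n) Ux))
      (¬-sym (W₀-U₁ (4 + n) Ww Uu)) u≁x (¬-sym w₁) (¬-sym (U≁₀ (1 + n) Ux))

    ≁⇒W₂-anticomplete : ∀ {w} → W (2 + n) w → ¬ w ~ u
    ≁⇒W₂-anticomplete Ww@(_ , _ , w₀) w~u = P₁+2P₂-free x₀ w~u
      (¬-sym (U≁₂ (1 + n) Ux)) (¬-sym (chord₃ n)) (¬-sym (W≁₁ (2 + n) Ww)) (¬-sym (U≁₃ n Uu))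
      (¬-sym (W₀-U₄ (2 + n) Ww Ux)) (¬-sym u≁x) (¬-sym w₀) (¬-sym (U≁₀ n Uu))

  -- Each of the two possible witnesses of `F` is incompatible with a missing edge `s u`. For the
  -- second, `s` and `u` are themselves the consecutive pair, with index `4 + n`, and
  -- `W (4 + (4 + n))` is `W (3 + n)`.
  F-complete : ∀ n {u s} → U n u → F n u → U (4 + n) s → s ~ u
  F-complete n Uu (t , inj₁ (Ut , t≁u)) Us = ≁⇒complete₄ n Uu Ut (¬-sym t≁u) Us
  F-complete n Uu (t , inj₂ (Wt , t~u)) Us = stable λ s≁u → ≁⇒W₄-anticomplete (4 + n) Us Uu s≁u Wt t~u

  F-anticomplete : ∀ n {u w} → U n u → F n u → W (2 + n) w → ¬ w ~ u
  F-anticomplete n Uu (t , inj₁ (Ut , t≁u)) Ww = ≁⇒W₂-anticomplete n Uu Ut (¬-sym t≁u) Ww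
  F-anticomplete n Uu (t , inj₂ (Wt , t~u)) Ww w~u = triangle-free (W₀-W₁ (2 + n) Ww Wt) t~u (~-sym w~u)

  ¬F-complete : ∀ n {u t} → ¬ F n u → U (1 + n) t → t ~ u
  ¬F-complete n ¬Fu Ut = stable λ t≁u → ¬Fu (_ , inj₁ (Ut , t≁u))

  ¬F-anticomplete : ∀ n {u t} → ¬ F n u → W (3 + n) t → ¬ t ~ u
  ¬F-anticomplete n ¬Fu Wt t~u = ¬Fu (_ , inj₂ (Wt , t~u))

  -- Here `y` is isolated from the edges joining `w` to `v n` and `x` to `v (3 + n)`.
  no-transversal : ∀ n {w x y} → W n w → U (2 + n) x → U (3 + n) y → ¬ w ~ x → ¬ x ~ y → ¬ y ~ w → ⊥
  no-transversal n (w₀ , _ , w₃) Ux Uy w≁x x≁y y≁w = P₁+2P₂-free w₀ (proj₂ Ux)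
    y≁w (U≁₂ (3 + n) Uy) (¬-sym x≁y) (U≁₀ (3 + n) Uy)
    w≁x w₃ (¬-sym (U≁₃ (2 + n) Ux)) (chord₃ n)

  -- Classes, blocks, and homogeneity across blocks.

  open Code (λ (i : Fin 5) y → y ~? v (toℕ i)) renaming (code to code~; code-resp to code~-resp)
  open Code (λ (i : Fin 5) y → F? (toℕ i) y) renaming (code to codeF; code-resp to codeF-resp)
  open Code (λ (_ : Fin 1) y → TouchesZ? y) renaming (code to codeZ; code-resp to codeZ-resp)

  code : Vertex → Fin (2 ^ 5 * (2 ^ 5 * 2 ^ 1))
  code y = combine (code~ y) (combine (codeF y) (codeZ y))

  module _ {x y : Vertex} (eq : code x ≡ code y) where

    private
      split  = combine-injective (code~ x) _ (code~ y) _ eq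
      split′ = combine-injective (codeF x) (codeZ x) (codeF y) (codeZ y) (proj₂ split)

    ~-resp : ∀ n → x ~ v n → y ~ v n
    ~-resp = periodic-induction {4} _ (λ _ → id) (code~-resp (proj₁ split))

    ≁-resp : ∀ n → ¬ x ~ v n → ¬ y ~ v n
    ≁-resp = periodic-induction {4} _ (λ _ → id)
      (λ i x≁ → x≁ ∘ code~-resp (sym (proj₁ split)) i)

    F-resp : ∀ n → F n x → F n y
    F-resp = periodic-induction {4} _ (λ _ → id) (codeF-resp (proj₁ split′))

    ¬F-resp : ∀ n → ¬ F n x → ¬ F n y
    ¬F-resp = periodic-induction {4} _ (λ _ → id)
      (λ i ¬Fx → ¬Fx ∘ codeF-resp (sym (proj₁ split′)) i)

    TouchesZ-resp : TouchesZ x → TouchesZ y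
    TouchesZ-resp = codeZ-resp (proj₂ split′) 0F

    U-resp : ∀ n → U n x → U n y
    U-resp n (p , q) = ~-resp (4 + n) p , ~-resp (1 + n) q

    W-resp : ∀ n → W n x → W n y
    W-resp n (p , q , r) = ~-resp n p , ≁-resp (2 + n) q , ≁-resp (3 + n) r

    Z-resp : Z x → Z y
    Z-resp Zx n = ≁-resp n (Zx n)

  -- Adjacency between different blocks, and with Z, depends on the classes only.
  Part : ℕ → Fin 3 → Vertex → Set
  Part n 0F y = W n y
  Part n 1F y = U (2 + n) y × F (2 + n) y
  Part n 2F y = U (3 + n) y × ¬ F (3 + n) y

  Block : ℕ → Vertex → Set
  Block n y = ∃[ r ] Part n r y

  Part? : ∀ n r y → Dec (Part n r y)
  Part? n 0F y = W? n y
  Part? n 1F y = U? (2 + n) y ×-dec F? (2 + n) y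
  Part? n 2F y = U? (3 + n) y ×-dec ¬? (F? (3 + n) y)

  Block? : ∀ n y → Dec (Block n y)
  Block? n y = any? λ r → Part? n r y

  part-resp : ∀ n {r x y} → code x ≡ code y → Part n r x → Part n r y
  part-resp n {0F} eq p       = W-resp eq n p
  part-resp n {1F} eq (p , q) = U-resp eq (2 + n) p , F-resp eq (2 + n) q
  part-resp n {2F} eq (p , q) = U-resp eq (3 + n) p , ¬F-resp eq (3 + n) q

  part-unique : ∀ n {r s x} → Part n r x → Part n s x → r ≡ s
  part-unique n {0F} {0F} _ _ = refl
  part-unique n {1F} {1F} _ _ = refl
  part-unique n {2F} {2F} _ _ = refl
  part-unique n {0F} {1F} p ((q , _) , _) = contradiction q (W≁₁ n p)
  part-unique n {0F} {2F} p ((_ , q) , _) = contradiction q (W≁₄ n p)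
  part-unique n {1F} {0F} ((q , _) , _) p = contradiction q (W≁₁ n p)
  part-unique n {1F} {2F} ((_ , q) , _) (p , _) = contradiction q (U≁₀ (3 + n) p)
  part-unique n {2F} {0F} ((_ , q) , _) p = contradiction q (W≁₄ n p)
  part-unique n {2F} {1F} (p , _) ((_ , q) , _) = contradiction q (U≁₀ (3 + n) p)

  part-independent : ∀ n {r x y} → Part n r x → Part n r y → ¬ x ~ y
  part-independent n {0F} p       q       = W₀-W₀ n p q
  part-independent n {1F} (p , _) (q , _) = U₀-U₀ (2 + n) p q
  part-independent n {2F} (p , _) (q , _) = U₀-U₀ (3 + n) p q

  -- Supplies the isolated vertex that turns a 2P₂ between two consecutive parts into P₁+2P₂.
  non-neighbour : ∀ n r → ∃[ z ] (∀ {x} → Part n r x → ¬ z ~ x) × (∀ {x} → Part n (next r) x → ¬ z ~ x)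
  non-neighbour n 0F = v (4 + n) , ¬-sym ∘ W≁₄ n , ¬-sym ∘ U≁₂ (2 + n) ∘ proj₁
  non-neighbour n 1F = v n , ¬-sym ∘ U≁₃ (2 + n) ∘ proj₁ , ¬-sym ∘ U≁₂ (3 + n) ∘ proj₁
  non-neighbour n 2F = v (1 + n) , ¬-sym ∘ U≁₃ (3 + n) ∘ proj₁ , ¬-sym ∘ W≁₁ n

  part-2P₂-free : ∀ n {r x x′ y y′} → Part n r x → Part n r x′ → Part n (next r) y → Part n (next r) y′ →
                  x ~ y → x′ ~ y′ → ¬ x ~ y′ → ¬ x′ ~ y → ⊥
  part-2P₂-free n {r} Px Px′ Py Py′ x~y x′~y′ x≁y′ x′≁y =
    let z , z≁ , z≁′ = non-neighbour n r
    in P₁+2P₂-free x~y x′~y′ (z≁ Px) (z≁′ Py) (z≁ Px′) (z≁′ Py′)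
         (part-independent n Px Px′) x≁y′ (¬-sym x′≁y) (part-independent n Py Py′)

  part-no-transversal : ∀ n {r x y z} → Part n r x → Part n (next r) y → Part n (next (next r)) z →
                        ¬ x ~ y → ¬ y ~ z → ¬ ¬ z ~ x
  part-no-transversal n {0F} p (q , _) (r , _) a b c = no-transversal n p q r a b c
  part-no-transversal n {1F} (p , _) (q , _) r a b c = no-transversal n r p q c a b
  part-no-transversal n {2F} (p , _) q (r , _) a b c = no-transversal n q r p b c a

  module _ (n : ℕ) {x x′ y y′ : Vertex} (y∉ : ¬ Block n y) (y′∉ : ¬ Block n y′)
    (eq : code y ≡ code y′) (x~y : x ~ y) where

    private
      impossible : ¬ x ~ y → x′ ~ y′
      impossible x≁y = contradiction x~y x≁y

      y-F : U (3 + n) y → F (3 + n) y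
      y-F Uy = decidable-stable (F? (3 + n) y) λ ¬Fy → y∉ (2F , Uy , ¬Fy)

    -- In this table and those below, `d` is the position of `y` relative to that of `x`. Each entry
    -- is a complete pair, a pair without edges, which contradicts `x ~ y`, or a position excluded
    -- because `y` lies outside the block.
    across-W-W : ∀ d → W n x → W n x′ → W (toℕ {5} d + n) y → W (toℕ {5} d + n) y′ → x′ ~ y′
    across-W-W 0F Wx Wx′ Wy Wy′ = impossible (W₀-W₀ n Wx Wy)
    across-W-W 1F Wx Wx′ Wy Wy′ = W₀-W₁ n Wx′ Wy′
    across-W-W 2F Wx Wx′ Wy Wy′ = impossible (W₀-W₂ n Wx Wy)
    across-W-W 3F Wx Wx′ Wy Wy′ = impossible (¬-sym (W₀-W₂ (3 + n) Wy Wx))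
    across-W-W 4F Wx Wx′ Wy Wy′ = ~-sym (W₀-W₁ (4 + n) Wy′ Wx′)

    across-W-U : ∀ d → W n x → W n x′ → U (toℕ {5} d + n) y → U (toℕ {5} d + n) y′ → x′ ~ y′
    across-W-U 0F Wx Wx′ Uy Uy′ = W₀-U₀ n Wx′ Uy′
    across-W-U 1F Wx Wx′ Uy Uy′ = impossible (W₀-U₁ n Wx Uy)
    across-W-U 2F Wx Wx′ Uy Uy′ = impossible (¬F-anticomplete (2 + n) (λ Fy → y∉ (1F , Uy , Fy)) Wx)
    across-W-U 3F Wx Wx′ Uy Uy′ = impossible (F-anticomplete (3 + n) Uy (y-F Uy) Wx)
    across-W-U 4F Wx Wx′ Uy Uy′ = impossible (W₀-U₄ n Wx Uy)

    across-F-W : ∀ d → Part n 1F x → Part n 1F x′ →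
                 W (toℕ {5} d + (2 + n)) y → W (toℕ {5} d + (2 + n)) y′ → x′ ~ y′
    across-F-W 0F _         (Ux′ , _) _  Wy′ = ~-sym (W₀-U₀ (2 + n) Wy′ Ux′)
    across-F-W 1F (Ux , _)  _         Wy _   = impossible (¬-sym (W₀-U₄ (3 + n) Wy Ux))
    across-F-W 2F (Ux , Fx) _         Wy _   = impossible (¬-sym (F-anticomplete (2 + n) Ux Fx Wy))
    across-F-W 3F _         _         Wy _   = contradiction (0F , Wy) y∉
    across-F-W 4F (Ux , _)  _         Wy _   = impossible (¬-sym (W₀-U₁ (6 + n) Wy Ux))

    across-F-U : ∀ d → Part n 1F x → Part n 1F x′ →
                 U (toℕ {5} d + (2 + n)) y → U (toℕ {5} d + (2 + n)) y′ → x′ ~ y′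
    across-F-U 0F (Ux , _) _           Uy _   = impossible (U₀-U₀ (2 + n) Ux Uy)
    -- Outside the block, a vertex of `U (3 + n)` satisfies `F`, which `y′` inherits by its class.
    across-F-U 1F _        (Ux′ , _)   Uy Uy′ = F-complete (3 + n) Uy′ (F-resp eq (3 + n) (y-F Uy)) Ux′
    across-F-U 2F (Ux , _) _           Uy _   = impossible (U₀-U₂ (2 + n) Ux Uy)
    across-F-U 3F (Ux , _) _           Uy _   = impossible (¬-sym (U₀-U₂ (5 + n) Uy Ux))
    across-F-U 4F _        (Ux′ , Fx′) _  Uy′ = ~-sym (F-complete (2 + n) Ux′ Fx′ Uy′)

    across-¬F-W : ∀ d → Part n 2F x → Part n 2F x′ →
                  W (toℕ {5} d + (3 + n)) y → W (toℕ {5} d + (3 + n)) y′ → x′ ~ y′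
    across-¬F-W 0F _         (Ux′ , _) _  Wy′ = ~-sym (W₀-U₀ (3 + n) Wy′ Ux′)
    across-¬F-W 1F (Ux , _)  _         Wy _   = impossible (¬-sym (W₀-U₄ (4 + n) Wy Ux))
    across-¬F-W 2F _         _         Wy _   = contradiction (0F , Wy) y∉
    across-¬F-W 3F (_ , ¬Fx) _         Wy _   = impossible (¬-sym (¬F-anticomplete (3 + n) ¬Fx Wy))
    across-¬F-W 4F (Ux , _)  _         Wy _   = impossible (¬-sym (W₀-U₁ (7 + n) Wy Ux))

    across-¬F-U : ∀ d → Part n 2F x → Part n 2F x′ →
                  U (toℕ {5} d + (3 + n)) y → U (toℕ {5} d + (3 + n)) y′ → x′ ~ y′
    across-¬F-U 0F (Ux , _) _            Uy _   = impossible (U₀-U₀ (3 + n) Ux Uy)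
    across-¬F-U 1F _        (_ , ¬Fx′)   _  Uy′ = ~-sym (¬F-complete (3 + n) ¬Fx′ Uy′)
    across-¬F-U 2F (Ux , _) _            Uy _   = impossible (U₀-U₂ (3 + n) Ux Uy)
    across-¬F-U 3F (Ux , _) _            Uy _   = impossible (¬-sym (U₀-U₂ (6 + n) Uy Ux))
    across-¬F-U 4F _        (Ux′ , _)    _  Uy′ = ¬F-complete (2 + n) (λ Fy′ → y′∉ (1F , Uy′ , Fy′)) Ux′

    -- As `x` touches `Z`, so does `x′`, which therefore sees all of `Z`.
    across-U-Z : ∀ m → code x ≡ code x′ → U m x′ → Z y → Z y′ → x′ ~ y′
    across-U-Z m eqx Ux′ Zy Zy′ =
      let z , Zz , z~x′ = TouchesZ-resp eqx (y , Zy , ~-sym x~y)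
      in ~-sym (Z-U-twins m Zz Zy′ Ux′ z~x′)

    module _ {P : ℕ → Vertex → Set} (P-cong : ∀ m n {y} → m ≋ n → P m y → P n y)
      (P-resp : ∀ n → P n y → P n y′) where

      relative : ∀ k m → (∀ d → P (toℕ {5} d + k) y → P (toℕ {5} d + k) y′ → x′ ~ y′) → P m y → x′ ~ y′
      relative k m cases Py =
        let d , m≋ = offset k m
            Pdy    = P-cong m (toℕ d + k) m≋ Py
        in cases d Pdy (P-resp (toℕ d + k) Pdy)

    across : code x ≡ code x′ → ∀ r → Part n r x → Part n r x′ → Kind y → x′ ~ y′
    across _   0F Px Px′ (isZ Zy)   = ~-sym (Z-W n (Z-resp eq Zy) Px′)
    across eqx 1F Px Px′ (isZ Zy)   = across-U-Z (2 + n) eqx (proj₁ Px′) Zy (Z-resp eq Zy)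
    across eqx 2F Px Px′ (isZ Zy)   = across-U-Z (3 + n) eqx (proj₁ Px′) Zy (Z-resp eq Zy)
    across _   0F Px Px′ (isW m Wy) = relative {W} W-cong (W-resp eq) n m (λ d → across-W-W d Px Px′) Wy
    across _   1F Px Px′ (isW m Wy) = relative {W} W-cong (W-resp eq) (2 + n) m (λ d → across-F-W d Px Px′) Wy
    across _   2F Px Px′ (isW m Wy) = relative {W} W-cong (W-resp eq) (3 + n) m (λ d → across-¬F-W d Px Px′) Wy
    across _   0F Px Px′ (isU m Uy) = relative {U} U-cong (U-resp eq) n m (λ d → across-W-U d Px Px′) Uy
    across _   1F Px Px′ (isU m Uy) = relative {U} U-cong (U-resp eq) (2 + n) m (λ d → across-F-U d Px Px′) Uy
    across _   2F Px Px′ (isU m Uy) = relative {U} U-cong (U-resp eq) (3 + n) m (λ d → across-¬F-U d Px Px′) Uy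

  -- Assembling the blocks.

  block-buildable : ∀ n L → (∀ {x} → x ∈ L → Block n x) → Buildable code L
  block-buildable n = Tripartite.buildable G code (Part n)
    (λ {r} {s} → part-unique n {r} {s}) (λ {r} → part-resp n {r}) (λ {r} → part-independent n {r})
    (λ {r} → part-2P₂-free n {r}) triangle-free (λ {r} → part-no-transversal n {r})

  -- Blocks are split off in turn, each being homogeneous to everything outside it. What remains at
  -- the end lies in the independent set `Z`.
  blocks-buildable : ∀ ns L → (∀ {x} → x ∈ L → Z x ⊎ ∃[ n ] n ∈ ns × Block n x) → Buildable code L
  blocks-buildable [] L cover = homogeneous⇒buildable G code L λ x∈ _ y∈ _ _ _ x~y →
    contradiction x~y (Z-Z (isZ-only x∈) (isZ-only y∈))
    where
    isZ-only : ∀ {x} → x ∈ L → Z x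
    isZ-only x∈ = [ id , (λ ()) ] (cover x∈)
  blocks-buildable (n ∷ ns) L cover = buildable-resp code ⊆ ⊇
    (buildable-++ code (λ x∈ x∈′ → proj₂ (outside⁻ x∈′) (proj₂ (inside⁻ x∈)))
      (λ {x} {x′} {y} {y′} x∈ _ y∈ y′∈ eqx eqy x~y →
        let r , Px = proj₂ (inside⁻ x∈)
        in across n (proj₂ (outside⁻ y∈)) (proj₂ (outside⁻ y′∈)) eqy x~y eqx r Px (part-resp n {r} eqx Px) (kind y))
      (block-buildable n inside (proj₂ ∘ inside⁻))
      (blocks-buildable ns outside cover′))
    where
    inside outside : List Vertex
    inside  = filter (Block? n) L
    outside = filter (¬? ∘ Block? n) L

    inside⁻ : ∀ {x} → x ∈ inside → x ∈ L × Block n x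
    inside⁻ = ∈-filter⁻ (Block? n) {xs = L}

    outside⁻ : ∀ {x} → x ∈ outside → x ∈ L × ¬ Block n x
    outside⁻ = ∈-filter⁻ (¬? ∘ Block? n) {xs = L}

    cover′ : ∀ {x} → x ∈ outside → Z x ⊎ ∃[ m ] m ∈ ns × Block m x
    cover′ x∈ with cover (proj₁ (outside⁻ x∈))
    ... | inj₁ Zx                   = inj₁ Zx
    ... | inj₂ (_ , here refl , Bx) = contradiction Bx (proj₂ (outside⁻ x∈))
    ... | inj₂ (m , there m∈ , Bx)  = inj₂ (m , m∈ , Bx)

    ⊆ : ∀ {x} → x ∈ inside ++ outside → x ∈ L
    ⊆ = [ proj₁ ∘ inside⁻ , proj₁ ∘ outside⁻ ] ∘ ∈-++⁻ inside

    ⊇ : ∀ {x} → x ∈ L → x ∈ inside ++ outside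
    ⊇ {x} x∈ with Block? n x
    ... | yes p = ∈-++⁺ˡ (∈-filter⁺ (Block? n) x∈ p)
    ... | no ¬p = ∈-++⁺ʳ inside (∈-filter⁺ (¬? ∘ Block? n) x∈ ¬p)

  Z-or-block : ∀ y → Z y ⊎ ∃[ n ] Block n y
  Z-or-block y with kind y
  ... | isZ Zy   = inj₁ Zy
  ... | isW n Wy = inj₂ (n , 0F , Wy)
  ... | isU n Uy with F? n y
  -- Modulo 5, `U n` occurs in block `n − 2` for vertices with `F`, and in block `n − 3` for the
  -- others.
  ... | yes Fy = inj₂ (3 + n , 1F , Uy , Fy)
  ... | no ¬Fy = inj₂ (2 + n , 2F , Uy , ¬Fy)

  buildable : ∀ L → Buildable code L
  buildable L = blocks-buildable (0 ∷ 1 ∷ 2 ∷ 3 ∷ 4 ∷ []) L λ {x} _ →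
    Sum.map₂ (λ (n , Bx) → residue n Bx) (Z-or-block x)
    where
    residue : ∀ {x} n → Block n x → ∃[ m ] m ∈ 0 ∷ 1 ∷ 2 ∷ 3 ∷ 4 ∷ [] × Block m x
    residue 0 Bx = _ , here refl , Bx
    residue 1 Bx = _ , there (here refl) , Bx
    residue 2 Bx = _ , there (there (here refl)) , Bx
    residue 3 Bx = _ , there (there (there (here refl))) , Bx
    residue 4 Bx = _ , there (there (there (there (here refl)))) , Bx
    -- `Part` computes only once the part is known; then indices `5 + n` and `n` agree
    -- definitionally.
    residue (ℕ.suc (ℕ.suc (ℕ.suc (ℕ.suc (ℕ.suc n))))) (0F , p) = residue n (0F , p)
    residue (ℕ.suc (ℕ.suc (ℕ.suc (ℕ.suc (ℕ.suc n))))) (1F , p) = residue n (1F , p)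
    residue (ℕ.suc (ℕ.suc (ℕ.suc (ℕ.suc (ℕ.suc n))))) (2F , p) = residue n (2F , p)

-- From forbidden induced subgraphs to adjacency conditions.

NoTwins : Graph → Set
NoTwins H = ∀ u w → u ≢ w → ∃[ t ] ¬ ((u H.~ t → w H.~ t) × (w H.~ t → u H.~ t))
  where module H = Graph H

noTwins? : ∀ H → Dec (NoTwins H)
noTwins? H = all? λ u → all? λ w → ¬? (u ≟ w) →-dec any? λ t →
    ¬? (((u H.~? t) →-dec (w H.~? t)) ×-dec ((w H.~? t) →-dec (u H.~? t)))
  where module H = Graph H

-- In a graph without twins the vertices are told apart by their adjacencies.
induced : ∀ {H G} → NoTwins H → (f : Graph.Vertex H → Graph.Vertex G) →
          (∀ u w → Graph._~_ H u w ⇔ Graph._~_ G (f u) (f w)) → H InducedIn G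
induced {H} {G} twinless f adjacent = f , (λ {u} {w} → injective u w) , adjacent
  where
  injective : ∀ u w → f u ≡ f w → u ≡ w
  injective u w fu≡fw = decidable-stable (u ≟ w) λ u≢w →
    let t , distinct = twinless u w u≢w
    in distinct (
      (λ p → from (adjacent w t) (subst (λ z → Graph._~_ G z (f t)) fu≡fw (to (adjacent u t) p))) ,
      (λ p → from (adjacent u t) (subst (λ z → Graph._~_ G z (f t)) (sym fu≡fw) (to (adjacent w t) p))))

module _ (G : Graph) where
  open Graph G

  module _ {H : Graph} {x y : Vertex} (u w : Graph.Vertex H) where

    private module H = Graph H

    both : {True (u H.~? w)} → x ~ y → u H.~ w ⇔ x ~ y
    both {u~w} x~y = mk⇔ (λ _ → x~y) (λ _ → toWitness u~w)

    neither : {False (u H.~? w)} → ¬ x ~ y → u H.~ w ⇔ x ~ y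
    neither {u≁w} x≁y = mk⇔ (λ p → contradiction p (toWitnessFalse u≁w)) (λ p → contradiction p x≁y)

  free⇒triangle-free : ¬ (K₃ InducedIn G) → TriangleFree G
  free⇒triangle-free free {x} {y} {z} x~y y~z z~x =
    free (induced {K₃} {G} (toWitness {a? = noTwins? K₃} _) f adjacent)
    where
    f : Fin 3 → Vertex
    f 0F = x
    f 1F = y
    f 2F = z

    adjacent : ∀ u w → Graph._~_ K₃ u w ⇔ f u ~ f w
    adjacent 0F 0F = neither {K₃} 0F 0F (~-irr refl)
    adjacent 0F 1F = both {K₃} 0F 1F x~y
    adjacent 0F 2F = both {K₃} 0F 2F (~-sym z~x)
    adjacent 1F 0F = both {K₃} 1F 0F (~-sym x~y)
    adjacent 1F 1F = neither {K₃} 1F 1F (~-irr refl)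
    adjacent 1F 2F = both {K₃} 1F 2F y~z
    adjacent 2F 0F = both {K₃} 2F 0F z~x
    adjacent 2F 1F = both {K₃} 2F 1F (~-sym y~z)
    adjacent 2F 2F = neither {K₃} 2F 2F (~-irr refl)

  free⇒P₁+2P₂-free : ¬ (P₁+2P₂ InducedIn G) → P₁+2P₂-Free G
  free⇒P₁+2P₂-free free {p} {a} {b} {c} {d} a~b c~d p≁a p≁b p≁c p≁d a≁c a≁d b≁c b≁d =
    free (induced {P₁+2P₂} {G} (toWitness {a? = noTwins? P₁+2P₂} _) f adjacent)
    where
    f : Fin 5 → Vertex
    f 0F = p
    f 1F = a
    f 2F = b
    f 3F = c
    f 4F = d

    adjacent : ∀ u w → Graph._~_ P₁+2P₂ u w ⇔ f u ~ f w
    adjacent 0F 0F = neither {P₁+2P₂} 0F 0F (~-irr refl)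
    adjacent 0F 1F = neither {P₁+2P₂} 0F 1F p≁a
    adjacent 0F 2F = neither {P₁+2P₂} 0F 2F p≁b
    adjacent 0F 3F = neither {P₁+2P₂} 0F 3F p≁c
    adjacent 0F 4F = neither {P₁+2P₂} 0F 4F p≁d
    adjacent 1F 0F = neither {P₁+2P₂} 1F 0F (≁-sym G p≁a)
    adjacent 1F 1F = neither {P₁+2P₂} 1F 1F (~-irr refl)
    adjacent 1F 2F = both {P₁+2P₂} 1F 2F a~b
    adjacent 1F 3F = neither {P₁+2P₂} 1F 3F a≁c
    adjacent 1F 4F = neither {P₁+2P₂} 1F 4F a≁d
    adjacent 2F 0F = neither {P₁+2P₂} 2F 0F (≁-sym G p≁b)
    adjacent 2F 1F = both {P₁+2P₂} 2F 1F (~-sym a~b)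
    adjacent 2F 2F = neither {P₁+2P₂} 2F 2F (~-irr refl)
    adjacent 2F 3F = neither {P₁+2P₂} 2F 3F b≁c
    adjacent 2F 4F = neither {P₁+2P₂} 2F 4F b≁d
    adjacent 3F 0F = neither {P₁+2P₂} 3F 0F (≁-sym G p≁c)
    adjacent 3F 1F = neither {P₁+2P₂} 3F 1F (≁-sym G a≁c)
    adjacent 3F 2F = neither {P₁+2P₂} 3F 2F (≁-sym G b≁c)
    adjacent 3F 3F = neither {P₁+2P₂} 3F 3F (~-irr refl)
    adjacent 3F 4F = both {P₁+2P₂} 3F 4F c~d
    adjacent 4F 0F = neither {P₁+2P₂} 4F 0F (≁-sym G p≁d)
    adjacent 4F 1F = neither {P₁+2P₂} 4F 1F (≁-sym G a≁d)
    adjacent 4F 2F = neither {P₁+2P₂} 4F 2F (≁-sym G b≁d)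
    adjacent 4F 3F = both {P₁+2P₂} 4F 3F (~-sym c~d)
    adjacent 4F 4F = neither {P₁+2P₂} 4F 4F (~-irr refl)

  5-walk? : Dec (∃[ a ] ∃[ b ] ∃[ c ] ∃[ d ] ∃[ e ] a ~ b × b ~ c × c ~ d × d ~ e × e ~ a)
  5-walk? = any? λ a → any? λ b → any? λ c → any? λ d → any? λ e →
    (a ~? b) ×-dec (b ~? c) ×-dec (c ~? d) ×-dec (d ~? e) ×-dec (e ~? a)

  7-walk? : Dec (∃[ a ] ∃[ b ] ∃[ c ] ∃[ d ] ∃[ e ] ∃[ f ] ∃[ g ]
                 a ~ b × b ~ c × c ~ d × d ~ e × e ~ f × f ~ g × g ~ a)
  7-walk? = any? λ a → any? λ b → any? λ c → any? λ d → any? λ e → any? λ f → any? λ g →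
    (a ~? b) ×-dec (b ~? c) ×-dec (c ~? d) ×-dec (d ~? e) ×-dec (e ~? f) ×-dec (f ~? g) ×-dec (g ~? a)

-- The bound on the clique-width.

labels : ℕ
labels = 2 * (2 ^ 5 * (2 ^ 5 * 2 ^ 1))

mainTheorem2 : BoundedCliqueWidth (Free (P₁+2P₂ ∷ K₃ ∷ []))
-- The 5-cycle case needs the most labels, two per class; the other cases have only 2 and `2 ^ 7`
-- classes.
mainTheorem2 = labels , bounded
  where
  bounded : ∀ G → Free (P₁+2P₂ ∷ K₃ ∷ []) G → cw G ≤ labels
  bounded G (¬P₁+2P₂ All.∷ ¬K₃ All.∷ All.[]) = cases (5-walk? G) (7-walk? G)
    where
    open Graph G
    open Construction G

    triangle-free : TriangleFree G
    triangle-free = free⇒triangle-free G ¬K₃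

    P₁+2P₂-free : P₁+2P₂-Free G
    P₁+2P₂-free = free⇒P₁+2P₂-free G ¬P₁+2P₂

    width : ∀ {k} {class : Vertex → Fin k} → {True (k + k ℕ.≤? labels)} →
            (∀ L → Buildable class L) → cw G ≤ labels
    width {class = class} {k+k≤} buildable =
      _ , toWitness k+k≤ , buildable⇒constructible class (buildable (allFin order))

    cases : Dec _ → Dec _ → cw G ≤ labels
    cases (yes (_ , _ , _ , _ , _ , e₀ , e₁ , e₂ , e₃ , e₄)) _ =
      width (FiveCycle.buildable G triangle-free P₁+2P₂-free e₀ e₁ e₂ e₃ e₄)
    cases (no none) (yes (_ , _ , _ , _ , _ , _ , _ , e₀ , e₁ , e₂ , e₃ , e₄ , e₅ , e₆)) =
      width (SevenCycle.buildable G triangle-free P₁+2P₂-free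
        (λ a b c d e → none (_ , _ , _ , _ , _ , a , b , c , d , e)) e₀ e₁ e₂ e₃ e₄ e₅ e₆)
    cases (no no5) (no no7) =
      let class , proper = Colouring.bipartite G triangle-free P₁+2P₂-free
            (λ a b c d e → no5 (_ , _ , _ , _ , _ , a , b , c , d , e))
            (λ a b c d e f g → no7 (_ , _ , _ , _ , _ , _ , _ , a , b , c , d , e , f , g))
      in width (Bipartite.buildable G P₁+2P₂-free class proper)
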